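{- Let $G$ be a connected graph, and let $e$ be a bridge in $G$. Suppose that $G_1$ and $G_2$ are the components of $G\setminus e$, and let $e=v_1\sim v_2$ with $v_1\in V(G_1)$ and $v_2\in V(G_2)$. Then $$\kappa(G)=\frac{m_{G_1}}{m_G}\kappa(G_1)+\frac{m_{G_2}}{m_G}\kappa(G_2)+\frac{m_{G_2}+1}{m_G}\mathbf{d}_{G_1}^TR_{G_1}\mathbf{e}_{v_1}+\frac{m_{G_1}+1}{m_G}\mathbf{d}_{G_2}^TR_{G_2}\mathbf{e}_{v_2}+\frac{(2m_{G_1}+1)(2m_{G_2}+1)}{2m_G}.$$
   Context: All graphs are finite, simple and undirected. For a graph $H$: $m_H$ is the number of edges; $\mathbf{d}_H$ is the column vector of vertex degrees; $\mathbf{e}_v$ is the standard basis vector indexed by the vertex $v$. $G\setminus e$ is $G$ with the edge $e$ removed; $e$ is a bridge of the connected graph $G$ if $G\setminus e$ is disconnected. For connected $H$, $R_H=[r^H_{u,v}]$ is the effective resistance matrix, $r^H_{u,v}=(\mathbf{e}_u-\mathbf{e}_v)^TL^\dagger(\mathbf{e}_u-\mathbf{e}_v)$ with $L^\dagger$ the Moore–Penrose inverse of the Laplacian matrix of $H$. Kemeny's constant $\kappa(H)$ of a connected graph $H$ is that of the simple random walk on $H$ (from a vertex, move to a uniformly random neighbour): $\kappa(H)=\sum_{j\neq i}\pi_jm_{i,j}$, where $\pi_j=\deg_H(j)/(2m_H)$ is the stationary distribution and $m_{i,j}$ is the mean first passage time from $i$ to $j$; it does not depend on $i$. For a graph with at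 least one edge, $\kappa(H)=\mathbf{d}_H^TR_H\mathbf{d}_H/(4m_H)$. For a single-vertex graph, $\kappa(H)=0$. -}

module Defs where

open import Data.Bool.Base using (Bool; true; false; T; _∧_; _∨_; not; if_then_else_)
open import Data.Bool.Properties using (∧-comm; ∨-comm)
open import Data.Fin.Base using (Fin; toℕ)
open import Data.Fin.Properties using (_≟_; _<?_)
open import Data.Integer.Base using (+_)
open import Data.Nat.Base as ℕ using (ℕ; zero; suc)
open import Data.Product.Base using (Σ-syntax; ∃-syntax; _×_)
open import Data.Rational.Base
  using (ℚ; 0ℚ; 1ℚ; _+_; _*_; _-_; _÷_; _<_; _/_; ∣_∣; ≢-nonZero)
open import Data.Rational.Properties using (+-0-commutativeMonoid)
  renaming (_≟_ to _≟ℚ_)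
open import Data.Vec.Functional using (Vector)
open import Function.Bundles using (_⇔_)
open import Function.Definitions using (Injective)
open import Relation.Binary.Construct.Closure.ReflexiveTransitive using (Star)
open import Relation.Binary.PropositionalEquality
  using (_≡_; _≢_; refl; cong; cong₂; trans)
open import Relation.Nullary using (¬_; yes; no; does)

open import Algebra.Properties.CommutativeMonoid.Sum +-0-commutativeMonoid public
  using (sum; sum-syntax)

------------------------------------------------------------------------
-- Rational scalars, vectors and matrices

2ℚ : ℚ
2ℚ = + 2 / 1

𝟙 : Bool → ℚ
𝟙 b = if b then 1ℚ else 0ℚ

-- Division made total by p ÷₀ 0 = 0.  In a connected graph, a zero
-- denominator below can only be the degree of the vertex, or the number of
-- edges, of a single-vertex graph.
infixl 7 _÷₀_
_÷₀_ : ℚ → ℚ → ℚ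
p ÷₀ q with q ≟ℚ 0ℚ
... | yes _  = 0ℚ
... | no q≢0 = _÷_ p q {{≢-nonZero q≢0}}

Matrix : ℕ → ℕ → Set
Matrix m n = Fin m → Fin n → ℚ

infixl 7 _∙_ _*ᵥ_ _*ₘ_
_∙_ : ∀ {n} → Vector ℚ n → Vector ℚ n → ℚ
x ∙ y = sum (λ i → x i * y i)

_*ᵥ_ : ∀ {m n} → Matrix m n → Vector ℚ n → Vector ℚ m
(A *ᵥ x) i = A i ∙ x

_*ₘ_ : ∀ {m n p} → Matrix m n → Matrix n p → Matrix m p
(A *ₘ B) i j = sum (λ k → A i k * B k j)

_ᵀ : ∀ {m n} → Matrix m n → Matrix n m
(A ᵀ) i j = A j i

basis : ∀ {n} → Fin n → Vector ℚ n
basis v u = 𝟙 (does (u ≟ v))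

infix 4 _≈ₘ_
_≈ₘ_ : ∀ {m n} → Matrix m n → Matrix m n → Set
A ≈ₘ B = ∀ i j → A i j ≡ B i j

-- The Moore–Penrose inverse of a rational matrix is itself rational, so
-- nothing is lost by working over ℚ instead of ℝ.
record IsMoorePenroseInverse {m n} (A : Matrix m n) (X : Matrix n m) : Set where
  field
    AXA≈A   : A *ₘ X *ₘ A ≈ₘ A
    XAX≈X   : X *ₘ A *ₘ X ≈ₘ X
    AX-symm : (A *ₘ X) ᵀ ≈ₘ A *ₘ X
    XA-symm : (X *ₘ A) ᵀ ≈ₘ X *ₘ A

------------------------------------------------------------------------
-- Finite simple graphs

record Graph (n : ℕ) : Set where
  field
    adj        : Fin n → Fin n → Bool
    adj-sym    : ∀ u v → adj u v ≡ adj v u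
    adj-irrefl : ∀ v → adj v v ≡ false

open Graph public

Adj : ∀ {n} → Graph n → Fin n → Fin n → Set
Adj G u v = T (adj G u v)

Reachable : ∀ {n} → Graph n → Fin n → Fin n → Set
Reachable G = Star (Adj G)

Connected : ∀ {n} → Graph n → Set
Connected G = ∀ u v → Reachable G u v

isPair : ∀ {n} (a b u v : Fin n) → Bool
isPair a b u v = (does (u ≟ a) ∧ does (v ≟ b)) ∨ (does (u ≟ b) ∧ does (v ≟ a))

isPair-sym : ∀ {n} (a b u v : Fin n) → isPair a b u v ≡ isPair a b v u
isPair-sym a b u v =
  trans (∨-comm (does (u ≟ a) ∧ does (v ≟ b)) _)
        (cong₂ _∨_ (∧-comm (does (u ≟ b)) _) (∧-comm (does (u ≟ a)) _))

removeEdge : ∀ {n} → Graph n → Fin n → Fin n → Graph n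
removeEdge G a b = record
  { adj        = λ u v → adj G u v ∧ not (isPair a b u v)
  ; adj-sym    = λ u v → cong₂ (λ x y → x ∧ not y) (adj-sym G u v) (isPair-sym a b u v)
  ; adj-irrefl = λ v → cong (_∧ not (isPair a b v v)) (adj-irrefl G v)
  }

IsBridge : ∀ {n} → Graph n → Fin n → Fin n → Set
IsBridge G a b = Adj G a b × ¬ Connected (removeEdge G a b)

-- H, embedded in G by ι, is a connected component of G: an induced subgraph
-- whose vertex set is an equivalence class of reachability in G.
record IsComponent {n k} (G : Graph n) (H : Graph k) (ι : Fin k → Fin n) : Set where
  field
    root      : Fin k
    injective : Injective _≡_ _≡_ ι
    induced   : ∀ a b → adj H a b ≡ adj G (ι a) (ι b)
    class     : ∀ v → Reachable G (ι root) v ⇔ (∃[ a ] ι a ≡ v)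

degree : ∀ {n} → Graph n → Vector ℚ n
degree {n} G v = ∑[ u < n ] 𝟙 (adj G v u)

-- Each edge is counted once, through its ordered pair of ends u < v.
edges : ∀ {n} → Graph n → ℚ
edges {n} G = ∑[ u < n ] (∑[ v < n ] 𝟙 (does (u <? v) ∧ adj G u v))

laplacian : ∀ {n} → Graph n → Matrix n n
laplacian G u v = (if does (u ≟ v) then degree G u else 0ℚ) - 𝟙 (adj G u v)

IsResistanceMatrix : ∀ {n} → Graph n → Matrix n n → Set
IsResistanceMatrix {n} G R =
  Σ[ L† ∈ Matrix n n ] IsMoorePenroseInverse (laplacian G) L† ×
    (∀ u v → let x = λ w → basis u w - basis v w in R u v ≡ x ∙ (L† *ᵥ x))

------------------------------------------------------------------------
-- Series and expectations

HasSum : (ℕ → ℚ) → ℚ → Set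
HasSum f s = ∀ ε → 0ℚ < ε →
  ∃[ N ] (∀ k → N ℕ.≤ k → ∣ (∑[ t < k ] f (toℕ t)) - s ∣ < ε)

-- For f t = Pr[T = t]: the random time T is almost surely finite and has
-- expected value μ.
record HasMean (f : ℕ → ℚ) (μ : ℚ) : Set where
  field
    total : HasSum f 1ℚ
    mean  : HasSum (λ t → (+ t / 1) * f t) μ

------------------------------------------------------------------------
-- The simple random walk and Kemeny's constant

transition : ∀ {n} → Graph n → Matrix n n
transition G u v = 𝟙 (adj G u v) ÷₀ degree G u

-- firstPassage G j t i is the probability that the walk started at i is at j
-- at time t and at none of the times 1, …, t - 1.
firstPassage : ∀ {n} → Graph n → Fin n → ℕ → Vector ℚ n
firstPassage     G j zero          i = 0ℚ
firstPassage     G j (suc zero)    i = transition G i j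
firstPassage {n} G j (suc (suc t)) i =
  ∑[ k < n ] (if does (k ≟ j) then 0ℚ
              else transition G i k * firstPassage G j (suc t) k)

IsMeanFirstPassageTime : ∀ {n} → Graph n → Fin n → Fin n → ℚ → Set
IsMeanFirstPassageTime G i j = HasMean (λ t → firstPassage G j t i)

stationary : ∀ {n} → Graph n → Vector ℚ n
stationary G j = degree G j ÷₀ (2ℚ * edges G)

-- Only the off-diagonal entries of M are constrained or used; κ is the
-- common value, over all starting vertices i, of the sum.
IsKemenyConstant : ∀ {n} → Graph n → ℚ → Set
IsKemenyConstant {n} G κ =
  Σ[ M ∈ Matrix n n ]
    (∀ i j → j ≢ i → IsMeanFirstPassageTime G i j (M i j)) ×
    (∀ i → κ ≡ ∑[ j < n ] (if does (j ≟ i) then 0ℚ else stationary G j * M i j))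

{-# OPTIONS --safe #-}
-- Let h j be the vector of mean hitting times of j, with h j j = 0, and let
-- Δ be the Laplacian operator.  Conditioning on the first step gives
-- Δ (h j) = degree away from j, and Σ (Δ f) = 0 for every f.  Take j in G₁.
-- Summing Δ (h j) over G₂ leaves only the flow through the bridge, so
-- h j v₂ - h j v₁ = 2 m₂ + 1.  Hence on G₁ the difference of h j and the
-- corresponding vector of G₁ is a potential with Laplacian
-- (2 m₂ + 2) (e_{v₁} - e_j), and its drop from v₁ to j is (2 m₂ + 2) times
-- the effective resistance.  Now sum degree j * h j v₁ = 2 m π_j m_{v₁,j}
-- over j in G₁, and, adding the cost 2 m₁ + 1 of crossing the bridge,
-- over j in G₂.
module Submission where

open import Defs
open import Algebra.Bundles using (CommutativeRing)
open import Data.Bool.Base using (Bool; true; false; T; if_then_else_; _∧_; _∨_; not)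
open import Data.Bool.Properties using (∧-identityʳ; ¬-not; T-≡)
open import Data.Fin.Base as Fin using (Fin; zero; suc; toℕ)
open import Data.Fin.Properties as Fin using (_≟_; _<?_)
open import Data.Integer.Base as ℤ using (+_)
import Data.Integer.Properties as ℤ
open import Data.Nat.Base as ℕ using (ℕ; zero; suc)
import Data.Nat.Properties as ℕ
open import Data.Product.Base using (∃-syntax; _×_; _,_; proj₁; proj₂)
open import Data.Rational.Base
open import Data.Rational.Properties as ℚ hiding (_≟_; _<?_)
open import Data.Rational.Solver using (module +-*-Solver)
import Data.Rational.Unnormalised.Base as ℚᵘ
import Data.Rational.Unnormalised.Properties as ℚᵘ
open import Data.Sum.Base using (_⊎_; inj₁; inj₂; [_,_]′)
open import Data.Vec.Functional using (Vector)
open import Function.Base using (_∘_)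
open import Function.Bundles using (Equivalence)
open import Function.Definitions using (Injective)
open import Relation.Binary.Construct.Closure.ReflexiveTransitive
  using (_◅_; _◅◅_; reverse) renaming (ε to nil)
open import Relation.Binary.PropositionalEquality
open import Relation.Nullary using (¬_; Dec; yes; no; does; contradiction)
open import Relation.Nullary.Decidable using (decidable-stable)

open import Algebra.Properties.CommutativeMonoid.Sum +-0-commutativeMonoid
  using (sum-cong-≗; ∑-distrib-+; ∑-comm)
open import Algebra.Properties.Semiring.Sum (CommutativeRing.semiring +-*-commutativeRing)
  using (*-distribˡ-sum; *-distribʳ-sum)
open +-*-Solver using (solve; _:=_; _:+_; _:*_; _:-_; :-_; con)

-- Finite sums and vectors

-- Mean first passage times are available only as sums of series, so the first-step equation rests
-- on uniqueness of limits: the series for the mean from time 2 on is summed once directly and once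
-- after grouping by the first step. That equation is silent at the target j itself, so the value of
-- Δ (h j) there has to come from elsewhere; the identity Σ (Δ f) = 0 supplies it. Since κ is the
-- same for every starting vertex, the start may be put at v₁. The degree of v₁ in G exceeds its
-- degree in G₁ by one, but the surplus is weighted by a hitting time from v₁ to itself, which is 0.
-- All quantities are carried in the form 2 m κ, with degrees in place of probabilities, and
-- division returns only at the very end. This also absorbs a side consisting of a single vertex,
-- where `transition` and `stationary` have denominator 0.

sum-zero : ∀ {n} {f : Vector ℚ n} → (∀ i → f i ≡ 0ℚ) → sum f ≡ 0ℚ
sum-zero {zero}  f≗0 = refl
sum-zero {suc n} f≗0 = trans (cong₂ _+_ (f≗0 zero) (sum-zero (f≗0 ∘ suc))) (+-identityˡ 0ℚ)

∑-distrib-- : ∀ {n} (f g : Vector ℚ n) → sum (λ i → f i - g i) ≡ sum f - sum g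
∑-distrib-- {zero}  f g = refl
∑-distrib-- {suc n} f g = trans (cong (_+_ (f zero - g zero)) (∑-distrib-- (f ∘ suc) (g ∘ suc)))
  (solve 4 (λ a b c d → (a :- b) :+ (c :- d) := (a :+ c) :- (b :+ d)) refl (f zero) (g zero) (sum (f ∘ suc)) (sum (g ∘ suc)))

∙-basis : ∀ {n} (f : Vector ℚ n) v → f ∙ basis v ≡ f v
∙-basis {suc n} f zero = begin
  f zero * 1ℚ + sum (λ u → f (suc u) * 0ℚ)
    ≡⟨ cong₂ _+_ (*-identityʳ (f zero)) (sum-zero (λ u → *-zeroʳ (f (suc u)))) ⟩
  f zero + 0ℚ                              ≡⟨ +-identityʳ (f zero) ⟩
  f zero                                   ∎
  where open ≡-Reasoning
∙-basis {suc n} f (suc v) = begin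
  f zero * 0ℚ + (f ∘ suc) ∙ basis v ≡⟨ cong₂ _+_ (*-zeroʳ (f zero)) (∙-basis (f ∘ suc) v) ⟩
  0ℚ + f (suc v)                    ≡⟨ +-identityˡ (f (suc v)) ⟩
  f (suc v)                         ∎
  where open ≡-Reasoning

basis-self : ∀ {n} (v : Fin n) → basis v v ≡ 1ℚ
basis-self v with v ≟ v
... | yes _  = refl
... | no v≢v = contradiction refl v≢v

basis-≢ : ∀ {n} {u v : Fin n} → u ≢ v → basis v u ≡ 0ℚ
basis-≢ {u = u} {v} u≢v with u ≟ v
... | yes u≡v = contradiction u≡v u≢v
... | no _    = refl

basis-sym : ∀ {n} (u v : Fin n) → basis v u ≡ basis u v
basis-sym u v with u ≟ v
... | yes refl = sym (basis-self u)
... | no u≢v   = sym (basis-≢ (u≢v ∘ sym))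

sum-basis : ∀ {n} (v : Fin n) → sum (basis v) ≡ 1ℚ
sum-basis v = trans (sum-cong-≗ (λ u → sym (*-identityˡ (basis v u)))) (∙-basis (λ _ → 1ℚ) v)

∙-comm : ∀ {n} (x y : Vector ℚ n) → x ∙ y ≡ y ∙ x
∙-comm x y = sum-cong-≗ (λ i → *-comm (x i) (y i))

∙-congˡ : ∀ {n} (x : Vector ℚ n) {y z : Vector ℚ n} → y ≗ z → x ∙ y ≡ x ∙ z
∙-congˡ x y≗z = sum-cong-≗ (λ i → cong (x i *_) (y≗z i))

∙-scaleʳ : ∀ {n} c (x y : Vector ℚ n) → x ∙ (λ i → c * y i) ≡ c * (x ∙ y)
∙-scaleʳ c x y = trans
  (sum-cong-≗ (λ i → solve 3 (λ c x y → x :* (c :* y) := c :* (x :* y)) refl c (x i) (y i)))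
  (sym (*-distribˡ-sum c (λ i → x i * y i)))

∙-basis-difference : ∀ {n} (f : Vector ℚ n) u v → f ∙ (λ w → basis u w - basis v w) ≡ f u - f v
∙-basis-difference f u v = begin
  sum (λ w → f w * (basis u w - basis v w))
    ≡⟨ sum-cong-≗ (λ w → solve 3 (λ f a b → f :* (a :- b) := f :* a :- f :* b) refl (f w) (basis u w) (basis v w)) ⟩
  sum (λ w → f w * basis u w - f w * basis v w)
    ≡⟨ ∑-distrib-- (λ w → f w * basis u w) (λ w → f w * basis v w) ⟩
  f ∙ basis u - f ∙ basis v                            ≡⟨ cong₂ _-_ (∙-basis f u) (∙-basis f v) ⟩
  f u - f v                                            ∎
  where open ≡-Reasoning

*ₘ-*ᵥ-assoc : ∀ {m n p} (A : Matrix m n) (B : Matrix n p) x → (A *ₘ B) *ᵥ x ≗ A *ᵥ (B *ᵥ x)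
*ₘ-*ᵥ-assoc {n = n} {p} A B x i = begin
  ∑[ j < p ] ((∑[ k < n ] (A i k * B k j)) * x j)
    ≡⟨ sum-cong-≗ (λ j → *-distribʳ-sum (x j) (λ k → A i k * B k j)) ⟩
  ∑[ j < p ] (∑[ k < n ] (A i k * B k j * x j))      ≡⟨ ∑-comm (λ j k → A i k * B k j * x j) ⟩
  ∑[ k < n ] (∑[ j < p ] (A i k * B k j * x j))
    ≡⟨ sum-cong-≗ (λ k → sum-cong-≗ (λ j → *-assoc (A i k) (B k j) (x j))) ⟩
  ∑[ k < n ] (∑[ j < p ] (A i k * (B k j * x j)))
    ≡⟨ sum-cong-≗ (λ k → *-distribˡ-sum (A i k) (λ j → B k j * x j)) ⟨
  ∑[ k < n ] (A i k * (∑[ j < p ] (B k j * x j)))    ∎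
  where open ≡-Reasoning

*ᵥ-adjoint : ∀ {m n} (A : Matrix m n) x y → x ∙ (A *ᵥ y) ≡ ((A ᵀ) *ᵥ x) ∙ y
*ᵥ-adjoint {m} {n} A x y = begin
  ∑[ i < m ] (x i * (∑[ j < n ] (A i j * y j)))
    ≡⟨ sum-cong-≗ (λ i → *-distribˡ-sum (x i) (λ j → A i j * y j)) ⟩
  ∑[ i < m ] (∑[ j < n ] (x i * (A i j * y j)))      ≡⟨ ∑-comm (λ i j → x i * (A i j * y j)) ⟩
  ∑[ j < n ] (∑[ i < m ] (x i * (A i j * y j)))
    ≡⟨ sum-cong-≗ (λ j → sum-cong-≗ (λ i → solve 3 (λ x a y → x :* (a :* y) := a :* x :* y) refl (x i) (A i j) (y j))) ⟩
  ∑[ j < n ] (∑[ i < m ] (A i j * x i * y j))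
    ≡⟨ sum-cong-≗ (λ j → *-distribʳ-sum (y j) (λ i → A i j * x i)) ⟨
  ∑[ j < n ] ((∑[ i < m ] (A i j * x i)) * y j)      ∎
  where open ≡-Reasoning

-- Symmetry moves the outer `A` across the inner product, and `A X A` then collapses to `A`. A
-- quadratic form in the pseudoinverse can thus be evaluated at any vector in the range of `A`
-- without knowing the entries of `X`.
∙-pseudoinverse : ∀ {n} (A X : Matrix n n) → A ᵀ ≈ₘ A → A *ₘ X *ₘ A ≈ₘ A → ∀ f →
                  (A *ᵥ f) ∙ (X *ᵥ (A *ᵥ f)) ≡ f ∙ (A *ᵥ f)
∙-pseudoinverse A X A-symm AXA≈A f = begin
  (A *ᵥ f) ∙ (X *ᵥ (A *ᵥ f))
    ≡⟨ sum-cong-≗ (λ i → cong (_* (X *ᵥ (A *ᵥ f)) i) (sum-cong-≗ (λ j → cong (_* f j) (sym (A-symm i j))))) ⟩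
  ((A ᵀ) *ᵥ f) ∙ (X *ᵥ (A *ᵥ f))    ≡⟨ *ᵥ-adjoint A f (X *ᵥ (A *ᵥ f)) ⟨
  f ∙ (A *ᵥ (X *ᵥ (A *ᵥ f)))        ≡⟨ ∙-congˡ f (λ i → sym (*ₘ-*ᵥ-assoc A X (A *ᵥ f) i)) ⟩
  f ∙ ((A *ₘ X) *ᵥ (A *ᵥ f))        ≡⟨ ∙-congˡ f (λ i → sym (*ₘ-*ᵥ-assoc (A *ₘ X) A f i)) ⟩
  f ∙ ((A *ₘ X *ₘ A) *ᵥ f)          ≡⟨ ∙-congˡ f (λ i → sum-cong-≗ (λ j → cong (_* f j) (AXA≈A i j))) ⟩
  f ∙ (A *ᵥ f)                      ∎
  where open ≡-Reasoning

-- The difference of `f` and `g` is supported at `j`, so its value there is its total, which is 0.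
-- This recovers a Laplacian at a hitting target, where conditioning on the first step gives no
-- equation.
agree-off-point : ∀ {n} {f g : Vector ℚ n} j → (∀ {i} → i ≢ j → f i ≡ g i) → sum f ≡ sum g → f ≗ g
agree-off-point {f = f} {g} j off sums i with i ≟ j
... | no i≢j   = off i≢j
... | yes refl = begin
  f i                                       ≡⟨ solve 2 (λ x y → x := (x :- y) :+ y) refl (f i) (g i) ⟩
  (f i - g i) + g i                         ≡⟨ cong (_+ g i) (∙-basis (λ k → f k - g k) i) ⟨
  (λ k → f k - g k) ∙ basis i + g i         ≡⟨ cong (_+ g i) (sum-cong-≗ concentrated) ⟩
  sum (λ k → f k - g k) + g i               ≡⟨ cong (_+ g i) (∑-distrib-- f g) ⟩
  (sum f - sum g) + g i                     ≡⟨ cong (λ s → (s - sum g) + g i) sums ⟩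
  (sum g - sum g) + g i                     ≡⟨ cong (_+ g i) (+-inverseʳ (sum g)) ⟩
  0ℚ + g i                                  ≡⟨ +-identityˡ (g i) ⟩
  g i                                       ∎
  where
  open ≡-Reasoning
  concentrated : ∀ k → (f k - g k) * basis i k ≡ f k - g k
  concentrated k = by-cases (k ≟ i)
    where
    by-cases : (d : Dec (k ≡ i)) → (f k - g k) * 𝟙 (does d) ≡ f k - g k
    by-cases (yes _)  = *-identityʳ (f k - g k)
    by-cases (no k≢i) = trans (*-zeroʳ (f k - g k))
      (sym (trans (cong (_- g k) (off k≢i)) (+-inverseʳ (g k))))

basis-*-at : ∀ {n} (v u : Fin n) (f : Vector ℚ n) → basis v u * f u ≡ basis v u * f v
basis-*-at v u f with u ≟ v
... | yes refl = refl
... | no _     = trans (*-zeroˡ (f u)) (sym (*-zeroˡ (f v)))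

-- The hypothesis counts preimages: each `u` has exactly one under `α` and `β` together. Weighting
-- `f u` by this count and exchanging the sums distributes `f` over the two index sets.
∑-coverage : ∀ {n m k} (α : Fin m → Fin n) (β : Fin k → Fin n) →
  (∀ u → sum (λ x → basis u (α x)) + sum (λ y → basis u (β y)) ≡ 1ℚ) →
  ∀ f → sum f ≡ sum (f ∘ α) + sum (f ∘ β)
∑-coverage {n} α β covered f = begin
  sum f
    ≡⟨ sum-cong-≗ (λ u → sym (trans (cong (f u *_) (covered u)) (*-identityʳ (f u)))) ⟩
  sum (λ u → f u * (count α u + count β u))
    ≡⟨ sum-cong-≗ (λ u → *-distribˡ-+ (f u) (count α u) (count β u)) ⟩
  sum (λ u → f u * count α u + f u * count β u)
    ≡⟨ ∑-distrib-+ (λ u → f u * count α u) (λ u → f u * count β u) ⟩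
  f ∙ count α + f ∙ count β                                        ≡⟨ cong₂ _+_ (pull α) (pull β) ⟩
  sum (f ∘ α) + sum (f ∘ β)                                        ∎
  where
  open ≡-Reasoning
  count : ∀ {l} → (Fin l → Fin n) → Vector ℚ n
  count γ u = sum (λ z → basis u (γ z))
  pull : ∀ {l} (γ : Fin l → Fin n) → f ∙ count γ ≡ sum (f ∘ γ)
  pull {l} γ = begin
    ∑[ u < n ] (f u * (∑[ z < l ] basis u (γ z)))
      ≡⟨ sum-cong-≗ (λ u → *-distribˡ-sum (f u) (λ z → basis u (γ z))) ⟩
    ∑[ u < n ] (∑[ z < l ] (f u * basis u (γ z)))      ≡⟨ ∑-comm (λ u z → f u * basis u (γ z)) ⟩
    ∑[ z < l ] (∑[ u < n ] (f u * basis u (γ z)))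
      ≡⟨ sum-cong-≗ (λ z → trans (sum-cong-≗ (λ u → cong (f u *_) (basis-sym (γ z) u))) (∙-basis f (γ z))) ⟩
    sum (f ∘ γ)                                        ∎

count-injective : ∀ {m n} {ι : Fin m → Fin n} → Injective _≡_ _≡_ ι → ∀ x → sum (λ z → basis (ι x) (ι z)) ≡ 1ℚ
count-injective {ι = ι} inj x = trans (sum-cong-≗ reflected) (sum-basis x)
  where
  reflected : ∀ z → basis (ι x) (ι z) ≡ basis x z
  reflected z = by-cases (z ≟ x)
    where
    by-cases : (d : Dec (z ≡ x)) → basis (ι x) (ι z) ≡ 𝟙 (does d)
    by-cases (yes z≡x) = trans (cong (basis (ι x)) (cong ι z≡x)) (basis-self (ι x))
    by-cases (no z≢x)  = basis-≢ (z≢x ∘ inj)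

-- Arithmetic and order

sum-nonneg : ∀ {n} {f : Vector ℚ n} → (∀ i → 0ℚ ≤ f i) → 0ℚ ≤ sum f
sum-nonneg {zero}  0≤f = ≤-refl
sum-nonneg {suc n} 0≤f = ≤-trans (≤-reflexive (sym (+-identityˡ 0ℚ))) (+-mono-≤ (0≤f zero) (sum-nonneg (0≤f ∘ suc)))

term≤sum : ∀ {n} {f : Vector ℚ n} → (∀ i → 0ℚ ≤ f i) → ∀ i → f i ≤ sum f
term≤sum {suc n} {f} 0≤f zero = ≤-trans (≤-reflexive (sym (+-identityʳ (f zero)))) (+-monoʳ-≤ (f zero) (sum-nonneg (0≤f ∘ suc)))
term≤sum {suc n} {f} 0≤f (suc i) = ≤-trans (term≤sum (0≤f ∘ suc) i)
  (≤-trans (≤-reflexive (sym (+-identityˡ (sum (f ∘ suc))))) (+-monoˡ-≤ (sum (f ∘ suc)) (0≤f zero)))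

0≤𝟙 : ∀ b → 0ℚ ≤ 𝟙 b
0≤𝟙 true  = nonNegative⁻¹ 1ℚ
0≤𝟙 false = ≤-refl

*-÷₀-cancel : ∀ {p q} → q ≢ 0ℚ → q * (p ÷₀ q) ≡ p
*-÷₀-cancel {p} {q} q≢0 with q ℚ.≟ 0ℚ
... | yes q≡0 = contradiction q≡0 q≢0
... | no q≢0′ = trans (*-comm q (p * 1/q)) (trans (*-assoc p 1/q q) (trans (cong (p *_) (*-inverseˡ q)) (*-identityʳ p)))
  where
  instance
    q-nonZero : NonZero q
    q-nonZero = ≢-nonZero q≢0′
  1/q = 1/ q

-- If `q` is 0, the bounds squeeze `p` to 0, in agreement with the convention for `÷₀`. The lone
-- vertex of an edgeless graph is thereby treated together with the generic case.
*-÷₀-≤ : ∀ {p q} → 0ℚ ≤ p → p ≤ q → q * (p ÷₀ q) ≡ p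
*-÷₀-≤ {p} {q} 0≤p p≤q = by-cases (q ℚ.≟ 0ℚ)
  where
  by-cases : Dec (q ≡ 0ℚ) → q * (p ÷₀ q) ≡ p
  by-cases (no q≢0)  = *-÷₀-cancel q≢0
  by-cases (yes q≡0) = trans (cong (_* (p ÷₀ q)) q≡0) (trans (*-zeroˡ (p ÷₀ q)) (≤-antisym 0≤p (subst (p ≤_) q≡0 p≤q)))

*-cancelˡ-≡ : ∀ c {p q} → c ≢ 0ℚ → c * p ≡ c * q → p ≡ q
*-cancelˡ-≡ c {p} {q} c≢0 cp≡cq = trans (sym (1/c*c* p)) (trans (cong (1/ c *_) cp≡cq) (1/c*c* q))
  where
  instance
    c-nonZero : NonZero c
    c-nonZero = ≢-nonZero c≢0
  1/c*c* : ∀ r → 1/ c * (c * r) ≡ r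
  1/c*c* r = trans (sym (*-assoc (1/ c) c r)) (trans (cong (_* r) (*-inverseˡ c)) (*-identityˡ r))

2*≡+ : ∀ p → 2ℚ * p ≡ p + p
2*≡+ p = trans (*-distribʳ-+ p 1ℚ 1ℚ) (cong₂ _+_ (*-identityˡ p) (*-identityˡ p))

-- For a variable `n` the normalised fraction does not compute, so the identity is checked on
-- unnormalised rationals. It splits the time weight t + 1 into t and 1.
suc/1 : ∀ n → + suc n / 1 ≡ + n / 1 + 1ℚ
suc/1 n = toℚᵘ-injective (begin
  toℚᵘ (+ suc n / 1)                 ≈⟨ toℚᵘ-fromℚᵘ (ℚᵘ.mkℚᵘ (+ suc n) 0) ⟩
  ℚᵘ.mkℚᵘ (+ suc n) 0
    ≈⟨ ℚᵘ.*≡* (cong (ℤ._* + 1) (trans (cong +_ (ℕ.+-comm 1 n)) (cong (ℤ._+ + 1) (sym (ℤ.*-identityʳ (+ n)))))) ⟩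
  ℚᵘ.mkℚᵘ (+ n) 0 ℚᵘ.+ ℚᵘ.1ℚᵘ        ≈⟨ ℚᵘ.+-congˡ ℚᵘ.1ℚᵘ (toℚᵘ-fromℚᵘ (ℚᵘ.mkℚᵘ (+ n) 0)) ⟨
  toℚᵘ (+ n / 1) ℚᵘ.+ toℚᵘ 1ℚ        ≈⟨ toℚᵘ-homo-+ (+ n / 1) 1ℚ ⟨
  toℚᵘ (+ n / 1 + 1ℚ)                ∎)
  where
  open ℚᵘ.≃-Reasoning

2*[+1] : ∀ p → 2ℚ * (p + 1ℚ) ≡ (2ℚ * p + 1ℚ) + 1ℚ
2*[+1] p = trans (*-distribˡ-+ 2ℚ p 1ℚ) (sym (+-assoc (2ℚ * p) 1ℚ 1ℚ))

-- Series

-- On partial sums this is `HasSum` by definition, so every limit law below carries over to series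
-- without conversion.
Tendsto : (ℕ → ℚ) → ℚ → Set
Tendsto a l = ∀ ε → 0ℚ < ε → ∃[ N ] (∀ k → N ℕ.≤ k → ∣ a k - l ∣ < ε)

½-pos : ∀ {ε} → 0ℚ < ε → 0ℚ < ε * ½
½-pos {ε} 0<ε = subst (_< ε * ½) (*-zeroˡ ½) (*-monoˡ-<-pos ½ 0<ε)

½+½ : ∀ ε → ε * ½ + ε * ½ ≡ ε
½+½ ε = trans (sym (*-distribˡ-+ ε ½ ½)) (*-identityʳ ε)

tendsto-cong : ∀ {a b l} → a ≗ b → Tendsto a l → Tendsto b l
tendsto-cong {l = l} a≗b A ε 0<ε with N , p ← A ε 0<ε =
  N , λ k N≤k → subst (λ x → ∣ x - l ∣ < ε) (a≗b k) (p k N≤k)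

tendsto-const : ∀ c → Tendsto (λ _ → c) c
tendsto-const c ε 0<ε = 0 , λ _ _ → subst (λ x → ∣ x ∣ < ε) (sym (+-inverseʳ c)) 0<ε

tendsto-+ : ∀ {a b l m} → Tendsto a l → Tendsto b m → Tendsto (λ k → a k + b k) (l + m)
tendsto-+ {a} {b} {l} {m} A B ε 0<ε
  with N , p ← A (ε * ½) (½-pos 0<ε) | M , q ← B (ε * ½) (½-pos 0<ε) =
  N ℕ.⊔ M , λ k N⊔M≤k → begin-strict
    ∣ (a k + b k) - (l + m) ∣
      ≡⟨ cong ∣_∣ (solve 4 (λ a b l m → (a :+ b) :- (l :+ m) := (a :- l) :+ (b :- m)) refl (a k) (b k) l m) ⟩
    ∣ (a k - l) + (b k - m) ∣     ≤⟨ ∣p+q∣≤∣p∣+∣q∣ (a k - l) (b k - m) ⟩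
    ∣ a k - l ∣ + ∣ b k - m ∣     <⟨ +-mono-< (p k (ℕ.m⊔n≤o⇒m≤o N M N⊔M≤k)) (q k (ℕ.m⊔n≤o⇒n≤o N M N⊔M≤k)) ⟩
    ε * ½ + ε * ½                 ≡⟨ ½+½ ε ⟩
    ε                             ∎
  where open ≤-Reasoning

tendsto-* : ∀ {a l} c → Tendsto a l → Tendsto (λ k → c * a k) (c * l)
tendsto-* {a} {l} c A with c ℚ.≟ 0ℚ
... | yes refl = subst (Tendsto (λ k → 0ℚ * a k)) (sym (*-zeroˡ l)) (tendsto-cong {λ _ → 0ℚ} {l = 0ℚ} (λ k → sym (*-zeroˡ (a k))) (tendsto-const 0ℚ))
... | no c≢0 = λ ε 0<ε → let N , p = A (1/∣c∣ * ε) (subst (_< 1/∣c∣ * ε) (*-zeroʳ 1/∣c∣) (*-monoʳ-<-pos 1/∣c∣ 0<ε)) in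
  N , λ k N≤k → begin-strict
    ∣ c * a k - c * l ∣
      ≡⟨ cong ∣_∣ (solve 3 (λ c a l → c :* a :- c :* l := c :* (a :- l)) refl c (a k) l) ⟩
    ∣ c * (a k - l) ∣       ≡⟨ ∣p*q∣≡∣p∣*∣q∣ c (a k - l) ⟩
    ∣ c ∣ * ∣ a k - l ∣     <⟨ *-monoʳ-<-pos ∣ c ∣ (p k N≤k) ⟩
    ∣ c ∣ * (1/∣c∣ * ε)     ≡⟨ *-assoc ∣ c ∣ 1/∣c∣ ε ⟨
    (∣ c ∣ * 1/∣c∣) * ε     ≡⟨ cong (_* ε) (*-inverseʳ ∣ c ∣) ⟩
    1ℚ * ε                  ≡⟨ *-identityˡ ε ⟩
    ε                       ∎
  where
  open ≤-Reasoning
  instance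
    ∣c∣≢0 : NonZero ∣ c ∣
    ∣c∣≢0 = ≢-nonZero (c≢0 ∘ ∣p∣≡0⇒p≡0 c)
    ∣c∣-pos : Positive ∣ c ∣
    ∣c∣-pos = nonNeg∧nonZero⇒pos ∣ c ∣ {{∣-∣-nonNeg c}}
  1/∣c∣ = 1/ ∣ c ∣
  instance
    1/∣c∣-pos : Positive 1/∣c∣
    1/∣c∣-pos = 1/pos⇒pos ∣ c ∣

tendsto-unique : ∀ {a l m} → Tendsto a l → Tendsto a m → l ≡ m
tendsto-unique {a} {l} {m} A B = decidable-stable (l ℚ.≟ m) absurd
  where
  open ≤-Reasoning
  ε = ∣ l - m ∣
  ε-pos : l ≢ m → 0ℚ < ε
  ε-pos l≢m = positive⁻¹ ε {{nonNeg∧nonZero⇒pos ε {{∣-∣-nonNeg (l - m)}} {{≢-nonZero ε≢0}}}}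
    where
    ε≢0 : ε ≢ 0ℚ
    ε≢0 ε≡0 = l≢m (trans (solve 2 (λ l m → l := (l :- m) :+ m) refl l m)
      (trans (cong (_+ m) (∣p∣≡0⇒p≡0 (l - m) ε≡0)) (+-identityˡ m)))
  absurd : ¬ (l ≢ m)
  absurd l≢m = <-irrefl refl (begin-strict
      ε                         ≡⟨ cong ∣_∣ (solve 3 (λ l m x → l :- m := (x :- m) :- (x :- l)) refl l m x) ⟩
      ∣ (x - m) - (x - l) ∣     ≤⟨ ∣p-q∣≤∣p∣+∣q∣ (x - m) (x - l) ⟩
      ∣ x - m ∣ + ∣ x - l ∣
        <⟨ +-mono-< (proj₂ B′ (N ℕ.⊔ M) (ℕ.m≤n⊔m N M)) (proj₂ A′ (N ℕ.⊔ M) (ℕ.m≤m⊔n N M)) ⟩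
      ε * ½ + ε * ½             ≡⟨ ½+½ ε ⟩
      ε                         ∎)
    where
    A′ = A (ε * ½) (½-pos (ε-pos l≢m))
    B′ = B (ε * ½) (½-pos (ε-pos l≢m))
    N = proj₁ A′
    M = proj₁ B′
    x = a (N ℕ.⊔ M)

partialSum : (ℕ → ℚ) → ℕ → ℚ
partialSum f k = ∑[ t < k ] f (toℕ t)

hasSum-unique : ∀ {f s s′} → HasSum f s → HasSum f s′ → s ≡ s′
hasSum-unique {f} = tendsto-unique {partialSum f}

hasSum-cong : ∀ {f g s} → f ≗ g → HasSum f s → HasSum g s
hasSum-cong {f} {s = s} f≗g = tendsto-cong {partialSum f} {l = s} (λ k → sum-cong-≗ {k} (λ t → f≗g (toℕ t)))

hasSum-zero : HasSum (λ _ → 0ℚ) 0ℚ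
hasSum-zero = tendsto-cong {λ _ → 0ℚ} {l = 0ℚ} (λ k → sym (sum-zero {k} (λ _ → refl))) (tendsto-const 0ℚ)

hasSum-+ : ∀ {f g s s′} → HasSum f s → HasSum g s′ → HasSum (λ t → f t + g t) (s + s′)
hasSum-+ {f} {g} {s} {s′} F G =
  tendsto-cong {λ k → partialSum f k + partialSum g k} {l = s + s′}
    (λ k → sym (∑-distrib-+ {k} (f ∘ toℕ) (g ∘ toℕ)))
    (tendsto-+ {partialSum f} {partialSum g} {s} {s′} F G)

hasSum-* : ∀ {f s} c → HasSum f s → HasSum (λ t → c * f t) (c * s)
hasSum-* {f} {s} c F =
  tendsto-cong {λ k → c * partialSum f k} {l = c * s}
    (λ k → *-distribˡ-sum {k} c (f ∘ toℕ)) (tendsto-* {partialSum f} {s} c F)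

hasSum-∑ : ∀ {n} {f : Fin n → ℕ → ℚ} {s : Fin n → ℚ} →
           (∀ i → HasSum (f i) (s i)) → HasSum (λ t → ∑[ i < n ] f i t) (sum s)
hasSum-∑ {zero}      F = hasSum-zero
hasSum-∑ {suc n} {f} {s} F =
  hasSum-+ {f zero} {λ t → ∑[ i < n ] f (suc i) t} {s zero} {sum (s ∘ suc)}
    (F zero) (hasSum-∑ {f = f ∘ suc} {s ∘ suc} (F ∘ suc))

hasSum-tail : ∀ {f s} → HasSum f s → HasSum (f ∘ suc) (s - f 0)
hasSum-tail {f} {s} F ε 0<ε with N , p ← F ε 0<ε = N , λ k N≤k →
  subst (λ x → ∣ x ∣ < ε)
    (solve 3 (λ a b s → (a :+ b) :- s := b :- (s :- a)) refl (f 0) (sum {k} (f ∘ suc ∘ toℕ)) s)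
    (p (suc k) (ℕ.m≤n⇒m≤1+n N≤k))

-- Hitting times and potentials

-- The diagonal of `M` is left free by `IsKemenyConstant`. Overwriting it with 0, the boundary value
-- at the target, lets one formula for the first step cover arrival at `j` as well.
hittingTime : ∀ {n} → Matrix n n → Fin n → Vector ℚ n
hittingTime M j i = if does (i ≟ j) then 0ℚ else M i j

hittingTime-self : ∀ {n} (M : Matrix n n) j → hittingTime M j j ≡ 0ℚ
hittingTime-self M j with j ≟ j
... | yes _  = refl
... | no j≢j = contradiction refl j≢j

hittingTime-≢ : ∀ {n} (M : Matrix n n) {i j} → i ≢ j → hittingTime M j i ≡ M i j
hittingTime-≢ M {i} {j} i≢j with i ≟ j
... | yes i≡j = contradiction i≡j i≢j
... | no _    = refl

MeanFirstPassageTimes : ∀ {n} → Graph n → Matrix n n → Set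
MeanFirstPassageTimes G M = ∀ i j → j ≢ i → IsMeanFirstPassageTime G i j (M i j)

module _ {n} (G : Graph n) where

  -- After a first step to `k`, a passage lasting t + 1 further steps gets weight t + 2 = (t + 1) +
  -- 1, so the mean `M k j` and the total probability 1 add up. Starting at t + 1 loses nothing, as
  -- `firstPassage` vanishes at time 0. A first step to `j` itself leaves no later passage to count.
  hasSum-weighted-restriction :
    ∀ {M} → MeanFirstPassageTimes G M → ∀ (c : ℚ) j k →
    HasSum (λ t → (+ suc (suc t) / 1) * (if does (k ≟ j) then 0ℚ else c * firstPassage G j (suc t) k))
           (if does (k ≟ j) then 0ℚ else c * (M k j + 1ℚ))
  hasSum-weighted-restriction {M} hM c j k with k ≟ j
  ... | yes _  = hasSum-cong {λ _ → 0ℚ} {s = 0ℚ} (λ t → sym (*-zeroʳ (+ suc (suc t) / 1))) hasSum-zero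
  ... | no k≢j =
    hasSum-cong {λ t → c * ((+ suc t / 1) * f (suc t) + f (suc t))} {s = c * (M k j + 1ℚ)} reweight
      (hasSum-* {λ t → (+ suc t / 1) * f (suc t) + f (suc t)} {M k j + 1ℚ} c
        (subst₂ (λ s s′ → HasSum (λ t → (+ suc t / 1) * f (suc t) + f (suc t)) (s + s′))
          (trans (cong (_-_ (M k j)) (*-zeroˡ 0ℚ)) (+-identityʳ (M k j))) (+-identityʳ 1ℚ)
          (hasSum-+ {λ t → (+ suc t / 1) * f (suc t)} {f ∘ suc}
            (hasSum-tail {λ t → (+ t / 1) * f t} (HasMean.mean (hM k j (k≢j ∘ sym))))
            (hasSum-tail {f} {1ℚ} (HasMean.total (hM k j (k≢j ∘ sym)))))))
    where
    f : ℕ → ℚ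
    f t = firstPassage G j t k
    open ≡-Reasoning
    reweight : ∀ t → c * ((+ suc t / 1) * f (suc t) + f (suc t)) ≡ (+ suc (suc t) / 1) * (c * f (suc t))
    reweight t = begin
      c * (a * x + x)                   ≡⟨ cong (λ y → c * (a * x + y)) (*-identityˡ x) ⟨
      c * (a * x + 1ℚ * x)
        ≡⟨ solve 4 (λ c a x o → c :* (a :* x :+ o :* x) := (a :+ o) :* (c :* x)) refl c a x 1ℚ ⟩
      (a + 1ℚ) * (c * x)                ≡⟨ cong (_* (c * x)) (suc/1 (suc t)) ⟨
      (+ suc (suc t) / 1) * (c * x)     ∎
      where
      a = + suc t / 1
      x = f (suc t)

  hittingTime-firstStep :
    ∀ {M} → MeanFirstPassageTimes G M → ∀ {i j} → i ≢ j →
    hittingTime M j i ≡ ∑[ k < n ] (transition G i k * (1ℚ + hittingTime M j k))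
  hittingTime-firstStep {M} hM {i} {j} i≢j = begin
    hittingTime M j i                          ≡⟨ hittingTime-≢ M i≢j ⟩
    M i j                                      ≡⟨ move (M i j) (p j) (sum rest) tails-agree ⟩
    p j + sum rest                             ≡⟨ cong (_+ sum rest) (∙-basis p j) ⟨
    p ∙ basis j + sum rest                     ≡⟨ ∑-distrib-+ (λ k → p k * basis j k) rest ⟨
    sum (λ k → p k * basis j k + rest k)       ≡⟨ sum-cong-≗ combine ⟩
    sum (λ k → p k * (1ℚ + hittingTime M j k)) ∎
    where
    open ≡-Reasoning
    p = transition G i
    rest : Vector ℚ n
    rest k = if does (k ≟ j) then 0ℚ else p k * (M k j + 1ℚ)
    f : ℕ → ℚ
    f t = firstPassage G j t i
    g : Fin n → ℕ → ℚ
    g k t = if does (k ≟ j) then 0ℚ else p k * firstPassage G j (suc t) k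

    -- Times 0 and 1 are split off because `firstPassage` recurs over the first step only from time
    -- 2 on; its value at time 1 is the direct step `p j`.
    tails-agree : (M i j - (+ 0 / 1) * 0ℚ) - (+ 1 / 1) * p j ≡ sum rest
    tails-agree = hasSum-unique {λ t → (+ suc (suc t) / 1) * f (suc (suc t))}
      (hasSum-tail {λ t → (+ suc t / 1) * f (suc t)}
        (hasSum-tail {λ t → (+ t / 1) * f t} (HasMean.mean (hM i j (i≢j ∘ sym)))))
      (hasSum-cong {λ t → ∑[ k < n ] ((+ suc (suc t) / 1) * g k t)} {s = sum rest}
        (λ t → sym (*-distribˡ-sum (+ suc (suc t) / 1) (λ k → g k t)))
        (hasSum-∑ {f = λ k t → (+ suc (suc t) / 1) * g k t} {rest}
          (λ k → hasSum-weighted-restriction hM (p k) j k)))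

    move : ∀ m a s → (m - (+ 0 / 1) * 0ℚ) - (+ 1 / 1) * a ≡ s → m ≡ a + s
    move m a s eq = begin
      m                                               ≡⟨ +-identityʳ m ⟨
      m - 0ℚ
        ≡⟨ solve 2 (λ x a → x := a :+ (x :- a)) refl (m - 0ℚ) a ⟩
      a + ((m - 0ℚ) - a)
        ≡⟨ cong₂ (λ x y → a + ((m - x) - y)) (*-zeroʳ (+ 0 / 1)) (*-identityˡ a) ⟨
      a + ((m - (+ 0 / 1) * 0ℚ) - (+ 1 / 1) * a)      ≡⟨ cong (_+_ a) eq ⟩
      a + s                                           ∎

    combine : ∀ k → p k * basis j k + rest k ≡ p k * (1ℚ + hittingTime M j k)
    combine k with k ≟ j
    ... | yes _ = trans (+-identityʳ (p k * 1ℚ)) (cong (p k *_) (sym (+-identityʳ 1ℚ)))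
    ... | no _  = trans (cong₂ _+_ (*-zeroʳ (p k)) (cong (p k *_) (+-comm (M k j) 1ℚ))) (+-identityˡ (p k * (1ℚ + M k j)))

-- The Laplacian operator, effective resistance and degree sums

module _ {n} (G : Graph n) where

  private
    a : Fin n → Fin n → ℚ
    a u v = 𝟙 (adj G u v)

  Δ : Vector ℚ n → Vector ℚ n
  Δ f u = ∑[ v < n ] (a u v * (f u - f v))

  Δ-split : ∀ f u → Δ f u ≡ f u * degree G u - ∑[ v < n ] (a u v * f v)
  Δ-split f u = begin
    sum (λ v → a u v * (f u - f v))
      ≡⟨ sum-cong-≗ (λ v → solve 3 (λ a x y → a :* (x :- y) := x :* a :- a :* y) refl (a u v) (f u) (f v)) ⟩
    sum (λ v → f u * a u v - a u v * f v)             ≡⟨ ∑-distrib-- (λ v → f u * a u v) (λ v → a u v * f v) ⟩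
    sum (λ v → f u * a u v) - sum (λ v → a u v * f v)
      ≡⟨ cong (_- sum (λ v → a u v * f v)) (*-distribˡ-sum (f u) (a u)) ⟨
    f u * degree G u - sum (λ v → a u v * f v)        ∎
    where open ≡-Reasoning

  Δ-distrib-- : ∀ f g u → Δ (λ v → f v - g v) u ≡ Δ f u - Δ g u
  Δ-distrib-- f g u = trans
    (sum-cong-≗ (λ v → solve 5 (λ a x y z w → a :* ((x :- y) :- (z :- w)) := a :* (x :- z) :- a :* (y :- w)) refl (a u v) (f u) (g u) (f v) (g v)))
    (∑-distrib-- (λ v → a u v * (f u - f v)) (λ v → a u v * (g u - g v)))

  -- Each edge contributes opposite differences from its two ends. As conservation of flow, this
  -- isolates the bridge when one side is summed, and it fixes the Laplacian at a target.
  sum-Δ : ∀ f → sum (Δ f) ≡ 0ℚ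
  sum-Δ f = begin
    sum (Δ f)
      ≡⟨ sum-cong-≗ (λ u → sum-cong-≗ (λ v → solve 3 (λ a x y → a :* (x :- y) := a :* x :- a :* y) refl (a u v) (f u) (f v))) ⟩
    ∑[ u < n ] (∑[ v < n ] (a u v * f u - a u v * f v))
      ≡⟨ sum-cong-≗ (λ u → ∑-distrib-- (λ v → a u v * f u) (λ v → a u v * f v)) ⟩
    ∑[ u < n ] (∑[ v < n ] (a u v * f u) - ∑[ v < n ] (a u v * f v))
      ≡⟨ ∑-distrib-- (λ u → ∑[ v < n ] (a u v * f u)) (λ u → ∑[ v < n ] (a u v * f v)) ⟩
    X - ∑[ u < n ] (∑[ v < n ] (a u v * f v))
      ≡⟨ cong (_-_ X) (∑-comm (λ u v → a u v * f v)) ⟩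
    X - ∑[ v < n ] (∑[ u < n ] (a u v * f v))
      ≡⟨ cong (_-_ X) (sum-cong-≗ (λ v → sum-cong-≗ (λ u → cong (λ b → 𝟙 b * f v) (adj-sym G u v)))) ⟩
    X - X                                                                             ≡⟨ +-inverseʳ X ⟩
    0ℚ                                                                                ∎
    where
    open ≡-Reasoning
    X = ∑[ u < n ] (∑[ v < n ] (a u v * f u))

  laplacian-*ᵥ : ∀ f → laplacian G *ᵥ f ≗ Δ f
  laplacian-*ᵥ f u = begin
    sum (λ v → laplacian G u v * f v)                              ≡⟨ sum-cong-≗ entry ⟩
    sum (λ v → degree G u * (f v * basis u v) - a u v * f v)
      ≡⟨ ∑-distrib-- (λ v → degree G u * (f v * basis u v)) (λ v → a u v * f v) ⟩
    sum (λ v → degree G u * (f v * basis u v)) - Y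
      ≡⟨ cong (_- Y) (*-distribˡ-sum (degree G u) (λ v → f v * basis u v)) ⟨
    degree G u * (f ∙ basis u) - Y
      ≡⟨ cong (λ x → degree G u * x - Y) (∙-basis f u) ⟩
    degree G u * f u - Y
      ≡⟨ cong (_- Y) (*-comm (degree G u) (f u)) ⟩
    f u * degree G u - Y                                           ≡⟨ Δ-split f u ⟨
    Δ f u                                                          ∎
    where
    open ≡-Reasoning
    Y = sum (λ v → a u v * f v)
    diagonal : ∀ d v → (if does (u ≟ v) then d else 0ℚ) ≡ d * basis u v
    diagonal d v = trans (on-bool (does (u ≟ v))) (cong (d *_) (basis-sym u v))
      where
      on-bool : ∀ b → (if b then d else 0ℚ) ≡ d * 𝟙 b
      on-bool true  = sym (*-identityʳ d)
      on-bool false = sym (*-zeroʳ d)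
    entry : ∀ v → laplacian G u v * f v ≡ degree G u * (f v * basis u v) - a u v * f v
    entry v = trans (cong (λ x → (x - a u v) * f v) (diagonal (degree G u) v))
      (solve 4 (λ d b a x → (d :* b :- a) :* x := d :* (x :* b) :- a :* x) refl (degree G u) (basis u v) (a u v) (f v))

  laplacian-symm : laplacian G ᵀ ≈ₘ laplacian G
  laplacian-symm u v = cong₂ _-_ diagonal (cong 𝟙 (adj-sym G v u))
    where
    diagonal : (if does (v ≟ u) then degree G v else 0ℚ) ≡ (if does (u ≟ v) then degree G u else 0ℚ)
    diagonal with v ≟ u | u ≟ v
    ... | yes _    | yes refl = refl
    ... | yes v≡u  | no u≢v   = contradiction (sym v≡u) u≢v
    ... | no v≢u   | yes u≡v  = contradiction (sym u≡v) v≢u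
    ... | no _     | no _     = refl

  -- Ohm's law for a current `c` entering at `u` and leaving at `v`. The energy `f ∙ (L *ᵥ f)`
  -- equals `c * (f u - f v)` directly, and through the pseudoinverse it equals `c * (c * R u v)`;
  -- one factor `c` cancels.
  resistance-potential :
    ∀ {R} → IsResistanceMatrix G R → ∀ {c} → c ≢ 0ℚ → ∀ f u v →
    (∀ w → Δ f w ≡ c * (basis u w - basis v w)) → f u - f v ≡ c * R u v
  resistance-potential {R} (X , mp , R≡) {c} c≢0 f u v Δf≡ = sym (*-cancelˡ-≡ c c≢0 (begin
    c * (c * R u v)             ≡⟨ cong (λ r → c * (c * r)) (R≡ u v) ⟩
    c * (c * (x ∙ (X *ᵥ x)))    ≡⟨ cong (c *_) (∙-scaleʳ c x (X *ᵥ x)) ⟨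
    c * (x ∙ (λ i → c * (X *ᵥ x) i))            ≡⟨ cong (c *_) (∙-congˡ x (λ i → sym (∙-scaleʳ c (X i) x))) ⟩
    c * (x ∙ (X *ᵥ cx))         ≡⟨ cong (c *_) (∙-comm x (X *ᵥ cx)) ⟩
    c * ((X *ᵥ cx) ∙ x)         ≡⟨ ∙-scaleʳ c (X *ᵥ cx) x ⟨
    (X *ᵥ cx) ∙ cx              ≡⟨ ∙-comm (X *ᵥ cx) cx ⟩
    cx ∙ (X *ᵥ cx)
      ≡⟨ sum-cong-≗ (λ i → cong₂ _*_ (sym (Lf≗cx i)) (∙-congˡ (X i) (λ j → sym (Lf≗cx j)))) ⟩
    (L *ᵥ f) ∙ (X *ᵥ (L *ᵥ f))  ≡⟨ ∙-pseudoinverse L X laplacian-symm (IsMoorePenroseInverse.AXA≈A mp) f ⟩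
    f ∙ (L *ᵥ f)                ≡⟨ ∙-congˡ f Lf≗cx ⟩
    f ∙ cx                      ≡⟨ ∙-scaleʳ c f x ⟩
    c * (f ∙ x)                 ≡⟨ cong (c *_) (∙-basis-difference f u v) ⟩
    c * (f u - f v)             ∎))
    where
    open ≡-Reasoning
    L = laplacian G
    x cx : Vector ℚ n
    x w = basis u w - basis v w
    cx w = c * x w
    Lf≗cx : L *ᵥ f ≗ cx
    Lf≗cx w = trans (laplacian-*ᵥ f w) (Δf≡ w)

  degree-nonneg : ∀ u → 0ℚ ≤ degree G u
  degree-nonneg u = sum-nonneg (λ v → 0≤𝟙 (adj G u v))

  degree-*-transition : ∀ u v → degree G u * transition G u v ≡ a u v
  degree-*-transition u v = *-÷₀-≤ (0≤𝟙 (adj G u v)) (term≤sum (λ w → 0≤𝟙 (adj G u w)) v)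

  -- Multiplying the first-step equation by the degree turns transition probabilities into adjacency
  -- entries. The unit cost of a step then sums to the degree, and the remaining terms cancel the
  -- neighbour sum in `Δ`.
  Δ-hittingTime : ∀ {M} → MeanFirstPassageTimes G M → ∀ {i j} → i ≢ j →
                  Δ (hittingTime M j) i ≡ degree G i
  Δ-hittingTime {M} hM {i} {j} i≢j = begin
    Δ h i                                                   ≡⟨ Δ-split h i ⟩
    h i * degree G i - S
      ≡⟨ cong (λ x → x * degree G i - S) (hittingTime-firstStep G hM i≢j) ⟩
    sum (λ k → p k * (1ℚ + h k)) * degree G i - S
      ≡⟨ cong (_- S) (*-distribʳ-sum (degree G i) (λ k → p k * (1ℚ + h k))) ⟩
    sum (λ k → p k * (1ℚ + h k) * degree G i) - S           ≡⟨ cong (_- S) (sum-cong-≗ term) ⟩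
    sum (λ k → a i k + a i k * h k) - S
      ≡⟨ cong (_- S) (∑-distrib-+ (a i) (λ k → a i k * h k)) ⟩
    (degree G i + S) - S
      ≡⟨ solve 2 (λ d s → (d :+ s) :- s := d) refl (degree G i) S ⟩
    degree G i                                              ∎
    where
    open ≡-Reasoning
    h = hittingTime M j
    p = transition G i
    S = sum (λ k → a i k * h k)
    term : ∀ k → p k * (1ℚ + h k) * degree G i ≡ a i k + a i k * h k
    term k = begin
      p k * (1ℚ + h k) * degree G i
        ≡⟨ solve 4 (λ p o h d → p :* (o :+ h) :* d := d :* p :* o :+ d :* p :* h) refl (p k) 1ℚ (h k) (degree G i) ⟩
      degree G i * p k * 1ℚ + degree G i * p k * h k
        ≡⟨ cong (λ x → x * 1ℚ + x * h k) (degree-*-transition i k) ⟩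
      a i k * 1ℚ + a i k * h k            ≡⟨ cong (_+ a i k * h k) (*-identityʳ (a i k)) ⟩
      a i k + a i k * h k                 ∎

  -- A transposed second copy of `edges` counts the pairs `v < u`. The diagonal, absent from both
  -- copies, carries no edge by irreflexivity.
  handshake : 2ℚ * edges G ≡ sum (degree G)
  handshake = begin
    2ℚ * edges G                                                            ≡⟨ 2*≡+ (edges G) ⟩
    edges G + edges G
      ≡⟨ cong (_+_ (edges G)) (∑-comm (λ u v → up u v)) ⟩
    edges G + ∑[ v < n ] (∑[ u < n ] up u v)
      ≡⟨ ∑-distrib-+ (λ u → sum (up u)) (λ v → ∑[ u < n ] up u v) ⟨
    ∑[ u < n ] (sum (up u) + ∑[ v < n ] up v u)
      ≡⟨ sum-cong-≗ (λ u → sym (∑-distrib-+ (up u) (λ v → up v u))) ⟩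
    ∑[ u < n ] (∑[ v < n ] (up u v + up v u))
      ≡⟨ sum-cong-≗ (λ u → sum-cong-≗ (λ v → up+down u v)) ⟩
    sum (degree G)                                                          ∎
    where
    open ≡-Reasoning
    up : Fin n → Fin n → ℚ
    up u v = 𝟙 (does (u <? v) ∧ adj G u v)
    up+down : ∀ u v → up u v + up v u ≡ a u v
    up+down u v = by-cases (u <? v) (v <? u)
      where
      by-cases : (d : Dec (u Fin.< v)) (e : Dec (v Fin.< u)) →
                 𝟙 (does d ∧ adj G u v) + 𝟙 (does e ∧ adj G v u) ≡ a u v
      by-cases (yes u<v) (yes v<u) = contradiction v<u (Fin.<-asym u<v)
      by-cases (yes _)   (no _)    = +-identityʳ (a u v)
      by-cases (no _)    (yes _)   = trans (+-identityˡ (a v u)) (cong 𝟙 (adj-sym G v u))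
      by-cases (no u≮v)  (no v≮u)  = trans (+-identityʳ 0ℚ)
        (cong 𝟙 (sym (trans (cong (adj G u) (Fin.≤-antisym (ℕ.≮⇒≥ u≮v) (ℕ.≮⇒≥ v≮u))) (adj-irrefl G u))))

  -- Clearing the denominator of `stationary` leaves the degree as weight, and the omitted term
  -- `j ≡ i` is the one where the hitting time is 0. The vertex `i` is arbitrary, so it can later be
  -- taken at an end of the bridge.
  sum-degree-hittingTime :
    ∀ {κ} ((M , _) : IsKemenyConstant G κ) i →
    ∑[ j < n ] (degree G j * hittingTime M j i) ≡ 2ℚ * edges G * κ
  sum-degree-hittingTime {κ} (M , _ , κ≡) i = sym (begin
    2ℚ * edges G * κ              ≡⟨ cong (2ℚ * edges G *_) (κ≡ i) ⟩
    2ℚ * edges G * sum weighted   ≡⟨ *-distribˡ-sum (2ℚ * edges G) weighted ⟩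
    ∑[ j < n ] (2ℚ * edges G * weighted j)
      ≡⟨ sum-cong-≗ (λ j → term (2ℚ * edges G) j (2m-*-stationary j)) ⟩
    ∑[ j < n ] (degree G j * hittingTime M j i)      ∎)
    where
    open ≡-Reasoning
    weighted : Vector ℚ n
    weighted j = if does (j ≟ i) then 0ℚ else stationary G j * M i j
    2m-*-stationary : ∀ j → 2ℚ * edges G * stationary G j ≡ degree G j
    2m-*-stationary j = *-÷₀-≤ (degree-nonneg j) (≤-trans (term≤sum degree-nonneg j) (≤-reflexive (sym handshake)))
    term : ∀ c j → c * stationary G j ≡ degree G j → c * weighted j ≡ degree G j * hittingTime M j i
    term c j eq = by-cases (j ≟ i)
      where
      by-cases : (d : Dec (j ≡ i)) → c * (if does d then 0ℚ else stationary G j * M i j) ≡ degree G j * hittingTime M j i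
      by-cases (yes refl) = trans (*-zeroʳ c) (sym (trans (cong (degree G j *_) (hittingTime-self M j)) (*-zeroʳ (degree G j))))
      by-cases (no j≢i)   = trans (sym (*-assoc c (stationary G j) (M i j))) (cong₂ _*_ eq (sym (hittingTime-≢ M (j≢i ∘ sym))))

-- Sums of two graphs along a bridge

-- The disjoint union of G₁ and G₂ with the edge v₁ ∼ v₂ added; that the ιᵢ
-- cover the vertices of G is expressed by ∑-split.
record BridgeSum {n n₁ n₂} (G : Graph n) (G₁ : Graph n₁) (G₂ : Graph n₂)
                 (ι₁ : Fin n₁ → Fin n) (ι₂ : Fin n₂ → Fin n)
                 (v₁ : Fin n₁) (v₂ : Fin n₂) : Set where
  field
    injective₁ : Injective _≡_ _≡_ ι₁
    injective₂ : Injective _≡_ _≡_ ι₂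
    disjoint   : ∀ x y → ι₁ x ≢ ι₂ y
    ∑-split    : ∀ f → sum f ≡ sum (f ∘ ι₁) + sum (f ∘ ι₂)
    induced₁   : ∀ x y → adj G (ι₁ x) (ι₁ y) ≡ adj G₁ x y
    induced₂   : ∀ x y → adj G (ι₂ x) (ι₂ y) ≡ adj G₂ x y
    across     : ∀ x y → 𝟙 (adj G (ι₁ x) (ι₂ y)) ≡ basis v₁ x * basis v₂ y

module _ {n n₁ n₂} {G : Graph n} {G₁ : Graph n₁} {G₂ : Graph n₂}
         {ι₁ : Fin n₁ → Fin n} {ι₂ : Fin n₂ → Fin n} {v₁ : Fin n₁} {v₂ : Fin n₂} where

  -- The configuration is symmetric, so facts proved for the first side are read off for the second.
  swap : BridgeSum G G₁ G₂ ι₁ ι₂ v₁ v₂ → BridgeSum G G₂ G₁ ι₂ ι₁ v₂ v₁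
  swap B = record
    { injective₁ = injective₂
    ; injective₂ = injective₁
    ; disjoint   = λ y x eq → disjoint x y (sym eq)
    ; ∑-split    = λ f → trans (∑-split f) (+-comm (sum (f ∘ ι₁)) (sum (f ∘ ι₂)))
    ; induced₁   = induced₂
    ; induced₂   = induced₁
    ; across     = λ y x → trans (cong 𝟙 (adj-sym G (ι₂ y) (ι₁ x)))
                             (trans (across x y) (*-comm (basis v₁ x) (basis v₂ y)))
    }
    where open BridgeSum B

  module _ (B : BridgeSum G G₁ G₂ ι₁ ι₂ v₁ v₂) where
    open BridgeSum B

    -- By `across`, a vertex `ι₁ x` has a neighbour on the other side only if `x` is `v₁`, and that
    -- neighbour is `ι₂ v₂`. Degrees and Laplacians of `G` are both sums of this shape.
    ∑-adjacent : ∀ f x → ∑[ w < n ] (𝟙 (adj G (ι₁ x) w) * f w)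
               ≡ ∑[ y < n₁ ] (𝟙 (adj G₁ x y) * f (ι₁ y)) + basis v₁ x * f (ι₂ v₂)
    ∑-adjacent f x = trans (∑-split (λ w → 𝟙 (adj G (ι₁ x) w) * f w)) (cong₂ _+_
      (sum-cong-≗ (λ y → cong (λ b → 𝟙 b * f (ι₁ y)) (induced₁ x y)))
      (begin
        ∑[ y < n₂ ] (𝟙 (adj G (ι₁ x) (ι₂ y)) * f (ι₂ y))
          ≡⟨ sum-cong-≗ (λ y → cong (_* f (ι₂ y)) (across x y)) ⟩
        ∑[ y < n₂ ] (basis v₁ x * basis v₂ y * f (ι₂ y))
          ≡⟨ sum-cong-≗ (λ y → solve 3 (λ a b c → a :* b :* c := a :* (c :* b)) refl (basis v₁ x) (basis v₂ y) (f (ι₂ y))) ⟩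
        ∑[ y < n₂ ] (basis v₁ x * (f (ι₂ y) * basis v₂ y))
          ≡⟨ *-distribˡ-sum (basis v₁ x) (λ y → f (ι₂ y) * basis v₂ y) ⟨
        basis v₁ x * ((f ∘ ι₂) ∙ basis v₂)                    ≡⟨ cong (basis v₁ x *_) (∙-basis (f ∘ ι₂) v₂) ⟩
        basis v₁ x * f (ι₂ v₂)                                ∎))
      where open ≡-Reasoning

    degree-ι₁ : ∀ x → degree G (ι₁ x) ≡ degree G₁ x + basis v₁ x
    degree-ι₁ x = begin
      degree G (ι₁ x)
        ≡⟨ sum-cong-≗ (λ w → sym (*-identityʳ (𝟙 (adj G (ι₁ x) w)))) ⟩
      ∑[ w < n ] (𝟙 (adj G (ι₁ x) w) * 1ℚ)                       ≡⟨ ∑-adjacent (λ _ → 1ℚ) x ⟩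
      ∑[ y < n₁ ] (𝟙 (adj G₁ x y) * 1ℚ) + basis v₁ x * 1ℚ
        ≡⟨ cong₂ _+_ (sum-cong-≗ (λ y → *-identityʳ (𝟙 (adj G₁ x y)))) (*-identityʳ (basis v₁ x)) ⟩
      degree G₁ x + basis v₁ x                                   ∎
      where open ≡-Reasoning

    sum-degree-ι₁ : sum (degree G ∘ ι₁) ≡ sum (degree G₁) + 1ℚ
    sum-degree-ι₁ = trans (sum-cong-≗ degree-ι₁)
      (trans (∑-distrib-+ (degree G₁) (basis v₁)) (cong (_+_ (sum (degree G₁))) (sum-basis v₁)))

    Δ-ι₁ : ∀ h x → Δ G h (ι₁ x) ≡ Δ G₁ (h ∘ ι₁) x + basis v₁ x * (h (ι₁ v₁) - h (ι₂ v₂))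
    Δ-ι₁ h x = trans (∑-adjacent (λ w → h (ι₁ x) - h w) x)
      (cong (_+_ (Δ G₁ (h ∘ ι₁) x)) (basis-*-at v₁ x (λ y → h (ι₁ y) - h (ι₂ v₂))))

    sum-Δ-ι₁ : ∀ h → sum (Δ G h ∘ ι₁) ≡ h (ι₁ v₁) - h (ι₂ v₂)
    sum-Δ-ι₁ h = begin
      sum (Δ G h ∘ ι₁)                                        ≡⟨ sum-cong-≗ (Δ-ι₁ h) ⟩
      sum (λ x → Δ G₁ (h ∘ ι₁) x + basis v₁ x * flow)
        ≡⟨ ∑-distrib-+ (Δ G₁ (h ∘ ι₁)) (λ x → basis v₁ x * flow) ⟩
      sum (Δ G₁ (h ∘ ι₁)) + sum (λ x → basis v₁ x * flow)
        ≡⟨ cong₂ _+_ (sum-Δ G₁ (h ∘ ι₁)) (sym (*-distribʳ-sum flow (basis v₁))) ⟩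
      0ℚ + sum (basis v₁) * flow                              ≡⟨ cong (λ s → 0ℚ + s * flow) (sum-basis v₁) ⟩
      0ℚ + 1ℚ * flow
        ≡⟨ trans (+-identityˡ (1ℚ * flow)) (*-identityˡ flow) ⟩
      flow                                                    ∎
      where
      open ≡-Reasoning
      flow = h (ι₁ v₁) - h (ι₂ v₂)

    -- With the target on the second side, the first side contains no exceptional vertex, so the
    -- hitting equation may be summed over all of it. The outcome is the total degree of that side
    -- in `G`, the same for every `y`.
    hittingTime-bridge : ∀ {M} → MeanFirstPassageTimes G M → ∀ y →
      hittingTime M (ι₂ y) (ι₁ v₁) - hittingTime M (ι₂ y) (ι₂ v₂) ≡ sum (degree G₁) + 1ℚ
    hittingTime-bridge {M} hM y = begin
      h (ι₁ v₁) - h (ι₂ v₂)     ≡⟨ sum-Δ-ι₁ h ⟨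
      sum (Δ G h ∘ ι₁)          ≡⟨ sum-cong-≗ (λ x → Δ-hittingTime G hM (disjoint x y)) ⟩
      sum (degree G ∘ ι₁)       ≡⟨ sum-degree-ι₁ ⟩
      sum (degree G₁) + 1ℚ      ∎
      where
      open ≡-Reasoning
      h = hittingTime M (ι₂ y)

0≤sum-degree : ∀ {n} (G : Graph n) → 0ℚ ≤ sum (degree G)
0≤sum-degree G = sum-nonneg (degree-nonneg G)

-- Hitting times within one side of the bridge

module _ {n n₁ n₂} {G : Graph n} {G₁ : Graph n₁} {G₂ : Graph n₂}
         {ι₁ : Fin n₁ → Fin n} {ι₂ : Fin n₂ → Fin n} {v₁ : Fin n₁} {v₂ : Fin n₂}
         (B : BridgeSum G G₁ G₂ ι₁ ι₂ v₁ v₂) where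
  open BridgeSum B

  private
    -- The first 1 belongs to the drop of the hitting times across the bridge, the second to the
    -- additional degree that the bridge gives to `v₁`.
    c = (sum (degree G₂) + 1ℚ) + 1ℚ

    c≢0 : c ≢ 0ℚ
    c≢0 c≡0 = <-irrefl (sym c≡0) (+-mono-≤-< {0ℚ} {sum (degree G₂) + 1ℚ} {0ℚ} {1ℚ}
      (+-mono-≤ {0ℚ} {sum (degree G₂)} {0ℚ} {1ℚ} (0≤sum-degree G₂) (nonNegative⁻¹ 1ℚ)) (positive⁻¹ 1ℚ))

  hittingTime-ι₁ : ∀ {M M₁ R₁} → MeanFirstPassageTimes G M → MeanFirstPassageTimes G₁ M₁ →
    IsResistanceMatrix G₁ R₁ → ∀ x →
    hittingTime M (ι₁ x) (ι₁ v₁) ≡ hittingTime M₁ x v₁ + c * R₁ x v₁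
  hittingTime-ι₁ {M} {M₁} {R₁} hM hM₁ hR₁ x = begin
    h (ι₁ v₁)
      ≡⟨ solve 2 (λ h k → h := k :+ (con 0ℚ :- (k :- h))) refl (h (ι₁ v₁)) (h₁ v₁) ⟩
    h₁ v₁ + (0ℚ - f v₁)                                ≡⟨ cong (λ z → h₁ v₁ + (z - f v₁)) f-x ⟨
    h₁ v₁ + (f x - f v₁)
      ≡⟨ cong (_+_ (h₁ v₁)) (resistance-potential G₁ hR₁ c≢0 f x v₁ Δf) ⟩
    h₁ v₁ + c * R₁ x v₁                                ∎
    where
    open ≡-Reasoning
    h = hittingTime M (ι₁ x)
    h₁ = hittingTime M₁ x
    f : Vector ℚ n₁
    f y = h₁ y - h (ι₁ y)

    f-x : f x ≡ 0ℚ
    f-x = trans (cong₂ _-_ (hittingTime-self M₁ x) (hittingTime-self M (ι₁ x))) (+-inverseʳ 0ℚ)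

    off-x : ∀ {y} → y ≢ x → Δ G₁ f y ≡ c * (basis x y - basis v₁ y)
    off-x {y} y≢x = begin
      Δ G₁ f y                                              ≡⟨ Δ-distrib-- G₁ h₁ (h ∘ ι₁) y ⟩
      Δ G₁ h₁ y - Δ G₁ (h ∘ ι₁) y
        -- Adding and subtracting the flow through the bridge completes `Δ G₁` to the Laplacian of
        -- `G`, whose value at `ι₁ y` is known.
        ≡⟨ solve 4 (λ d e b k → d :- e := d :- ((e :+ b :* (:- k)) :+ b :* k)) refl (Δ G₁ h₁ y) (Δ G₁ (h ∘ ι₁) y) b k ⟩
      Δ G₁ h₁ y - ((Δ G₁ (h ∘ ι₁) y + b * - k) + b * k)
        ≡⟨ cong₂ (λ p q → p - (q + b * k)) (Δ-hittingTime G₁ hM₁ y≢x) flux ⟩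
      degree G₁ y - ((degree G₁ y + b) + b * k)
        ≡⟨ cong (λ z → degree G₁ y - ((degree G₁ y + z) + b * k)) (*-identityʳ b) ⟨
      degree G₁ y - ((degree G₁ y + b * 1ℚ) + b * k)
        ≡⟨ solve 4 (λ d b k o → d :- ((d :+ b :* o) :+ b :* k) := (k :+ o) :* (con 0ℚ :- b)) refl (degree G₁ y) b k 1ℚ ⟩
      (k + 1ℚ) * (0ℚ - b)                                   ≡⟨ cong (λ z → (k + 1ℚ) * (z - b)) (basis-≢ y≢x) ⟨
      (k + 1ℚ) * (basis x y - b)
        ≡⟨ cong (λ z → (z + 1ℚ) * (basis x y - b)) (hittingTime-bridge (swap B) hM x) ⟩
      c * (basis x y - b)                                   ∎
      where
      b = basis v₁ y
      k = h (ι₂ v₂) - h (ι₁ v₁)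
      flux : Δ G₁ (h ∘ ι₁) y + b * - k ≡ degree G₁ y + b
      flux = begin
        Δ G₁ (h ∘ ι₁) y + b * - k
          ≡⟨ cong (λ z → Δ G₁ (h ∘ ι₁) y + b * z) (solve 2 (λ p q → :- (p :- q) := q :- p) refl (h (ι₂ v₂)) (h (ι₁ v₁))) ⟩
        Δ G₁ (h ∘ ι₁) y + b * (h (ι₁ v₁) - h (ι₂ v₂))       ≡⟨ Δ-ι₁ B h y ⟨
        Δ G h (ι₁ y)                                        ≡⟨ Δ-hittingTime G hM (y≢x ∘ injective₁) ⟩
        degree G (ι₁ y)                                     ≡⟨ degree-ι₁ B y ⟩
        degree G₁ y + b                                     ∎

    -- At `y = x` neither hitting equation is available; the value follows because both sides have
    -- total 0.
    Δf : ∀ y → Δ G₁ f y ≡ c * (basis x y - basis v₁ y)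
    Δf = agree-off-point x off-x (begin
      sum (Δ G₁ f)                                   ≡⟨ sum-Δ G₁ f ⟩
      0ℚ                                             ≡⟨ *-zeroʳ c ⟨
      c * 0ℚ                                         ≡⟨ cong (c *_) (+-inverseʳ 1ℚ) ⟨
      c * (1ℚ - 1ℚ)
        ≡⟨ cong₂ (λ p q → c * (p - q)) (sum-basis x) (sum-basis v₁) ⟨
      c * (sum (basis x) - sum (basis v₁))           ≡⟨ cong (c *_) (∑-distrib-- (basis x) (basis v₁)) ⟨
      c * sum (λ y → basis x y - basis v₁ y)         ≡⟨ *-distribˡ-sum c (λ y → basis x y - basis v₁ y) ⟩
      sum (λ y → c * (basis x y - basis v₁ y))       ∎)

  sum-degree-hittingTime-ι₁ : ∀ {M R₁ κ₁} → MeanFirstPassageTimes G M →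
    IsKemenyConstant G₁ κ₁ → IsResistanceMatrix G₁ R₁ →
    ∑[ x < n₁ ] (degree G (ι₁ x) * hittingTime M (ι₁ x) (ι₁ v₁))
      ≡ 2ℚ * edges G₁ * κ₁ + c * (degree G₁ ∙ (R₁ *ᵥ basis v₁))
  sum-degree-hittingTime-ι₁ {M} {R₁} {κ₁} hM hκ₁@(M₁ , hM₁ , _) hR₁ = begin
    sum (λ x → degree G (ι₁ x) * t x)
      ≡⟨ sum-cong-≗ (λ x → trans (cong (_* t x) (degree-ι₁ B x)) (*-distribʳ-+ (t x) (degree G₁ x) (basis v₁ x))) ⟩
    sum (λ x → degree G₁ x * t x + basis v₁ x * t x)
      -- The degree added by the bridge sits at `v₁`, where the hitting time to be weighted is 0.
      ≡⟨ sum-cong-≗ (λ x → trans (cong (_+_ (degree G₁ x * t x)) (vanish x)) (+-identityʳ (degree G₁ x * t x))) ⟩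
    sum (λ x → degree G₁ x * t x)                                      ≡⟨ sum-cong-≗ term ⟩
    sum (λ x → degree G₁ x * t₁ x + c * (degree G₁ x * R₁ x v₁))
      ≡⟨ ∑-distrib-+ (λ x → degree G₁ x * t₁ x) (λ x → c * (degree G₁ x * R₁ x v₁)) ⟩
    sum (λ x → degree G₁ x * t₁ x) + sum (λ x → c * (degree G₁ x * R₁ x v₁))
                                                                       ≡⟨ cong₂ _+_ (sum-degree-hittingTime G₁ hκ₁ v₁) (sym (*-distribˡ-sum c (λ x → degree G₁ x * R₁ x v₁))) ⟩
    2ℚ * edges G₁ * κ₁ + c * sum (λ x → degree G₁ x * R₁ x v₁)
      ≡⟨ cong (λ z → 2ℚ * edges G₁ * κ₁ + c * z) (∙-congˡ (degree G₁) (λ x → sym (∙-basis (R₁ x) v₁))) ⟩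
    2ℚ * edges G₁ * κ₁ + c * (degree G₁ ∙ (R₁ *ᵥ basis v₁))            ∎
    where
    open ≡-Reasoning
    t t₁ : Vector ℚ n₁
    t x = hittingTime M (ι₁ x) (ι₁ v₁)
    t₁ x = hittingTime M₁ x v₁
    vanish : ∀ x → basis v₁ x * t x ≡ 0ℚ
    vanish x = trans (basis-*-at v₁ x t) (trans (cong (basis v₁ x *_) (hittingTime-self M (ι₁ v₁))) (*-zeroʳ (basis v₁ x)))
    term : ∀ x → degree G₁ x * t x ≡ degree G₁ x * t₁ x + c * (degree G₁ x * R₁ x v₁)
    term x = trans (cong (degree G₁ x *_) (hittingTime-ι₁ hM hM₁ hR₁ x))
      (solve 4 (λ d t c r → d :* (t :+ c :* r) := d :* t :+ c :* (d :* r)) refl (degree G₁ x) (t₁ x) c (R₁ x v₁))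

-- Assembly of Kemeny's constant from the two sides

module _ {n n₁ n₂} {G : Graph n} {G₁ : Graph n₁} {G₂ : Graph n₂}
         {ι₁ : Fin n₁ → Fin n} {ι₂ : Fin n₂ → Fin n} {v₁ : Fin n₁} {v₂ : Fin n₂}
         (B : BridgeSum G G₁ G₂ ι₁ ι₂ v₁ v₂) where
  open BridgeSum B

  -- The degree sum of `G` splits into one positive part per side. Hence `÷₀` is genuine division in
  -- the final formula.
  bridgeSum-edges≢0 : 2ℚ * edges G ≢ 0ℚ
  bridgeSum-edges≢0 2m≡0 = <-irrefl (trans (sym 2m≡0) 2m≡) (+-mono-< (0<D+1 G₁) (0<D+1 G₂))
    where
    2m≡ : 2ℚ * edges G ≡ (sum (degree G₁) + 1ℚ) + (sum (degree G₂) + 1ℚ)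
    2m≡ = trans (handshake G) (trans (∑-split (degree G)) (cong₂ _+_ (sum-degree-ι₁ B) (sum-degree-ι₁ (swap B))))
    0<D+1 : ∀ {k} (H : Graph k) → 0ℚ < sum (degree H) + 1ℚ
    0<D+1 H = +-mono-≤-< {0ℚ} {sum (degree H)} {0ℚ} {1ℚ} (0≤sum-degree H) (positive⁻¹ 1ℚ)

  -- The walk starts at `ι₁ v₁`. Every target on the second side incurs the same crossing cost 2 m₁
  -- + 1, and the degrees in `G` of these targets add up to 2 m₂ + 1; this is the origin of the
  -- product term.
  bridgeSum-kemeny-scaled :
    ∀ {R₁ R₂ κ κ₁ κ₂} → IsResistanceMatrix G₁ R₁ → IsResistanceMatrix G₂ R₂ →
    IsKemenyConstant G κ → IsKemenyConstant G₁ κ₁ → IsKemenyConstant G₂ κ₂ →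
    2ℚ * edges G * κ ≡
      (2ℚ * edges G₁ * κ₁ + 2ℚ * (edges G₂ + 1ℚ) * (degree G₁ ∙ (R₁ *ᵥ basis v₁)))
      + ((2ℚ * edges G₂ * κ₂ + 2ℚ * (edges G₁ + 1ℚ) * (degree G₂ ∙ (R₂ *ᵥ basis v₂)))
         + (2ℚ * edges G₁ + 1ℚ) * (2ℚ * edges G₂ + 1ℚ))
  bridgeSum-kemeny-scaled {R₁} {R₂} {κ} {κ₁} {κ₂} hR₁ hR₂ hκ@(M , hM , _) hκ₁ hκ₂ = begin
    2ℚ * edges G * κ
      ≡⟨ sum-degree-hittingTime G hκ (ι₁ v₁) ⟨
    sum (λ j → degree G j * hittingTime M j (ι₁ v₁))
      ≡⟨ ∑-split (λ j → degree G j * hittingTime M j (ι₁ v₁)) ⟩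
    sum (λ x → degree G (ι₁ x) * hittingTime M (ι₁ x) (ι₁ v₁))
      + sum (λ y → d y * hittingTime M (ι₂ y) (ι₁ v₁))
        ≡⟨ cong₂ _+_ (sum-degree-hittingTime-ι₁ B hM hκ₁ hR₁) second ⟩
    (2ℚ * edges G₁ * κ₁ + ((sum (degree G₂) + 1ℚ) + 1ℚ) * S₁)
      + ((2ℚ * edges G₂ * κ₂ + ((sum (degree G₁) + 1ℚ) + 1ℚ) * S₂)
         + (sum (degree G₁) + 1ℚ) * (sum (degree G₂) + 1ℚ))
           ≡⟨ cong₂ expr (handshake G₁) (handshake G₂) ⟨
    expr (2ℚ * edges G₁) (2ℚ * edges G₂)
      ≡⟨ cong₂ (λ p q → (2ℚ * edges G₁ * κ₁ + q * S₁) + ((2ℚ * edges G₂ * κ₂ + p * S₂) + (2ℚ * edges G₁ + 1ℚ) * (2ℚ * edges G₂ + 1ℚ)))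
                                                                               (2*[+1] (edges G₁)) (2*[+1] (edges G₂)) ⟨
    (2ℚ * edges G₁ * κ₁ + 2ℚ * (edges G₂ + 1ℚ) * S₁)
      + ((2ℚ * edges G₂ * κ₂ + 2ℚ * (edges G₁ + 1ℚ) * S₂)
         + (2ℚ * edges G₁ + 1ℚ) * (2ℚ * edges G₂ + 1ℚ))                   ∎
    where
    open ≡-Reasoning
    S₁ = degree G₁ ∙ (R₁ *ᵥ basis v₁)
    S₂ = degree G₂ ∙ (R₂ *ᵥ basis v₂)
    expr : ℚ → ℚ → ℚ
    expr D₁ D₂ = (2ℚ * edges G₁ * κ₁ + ((D₂ + 1ℚ) + 1ℚ) * S₁)
               + ((2ℚ * edges G₂ * κ₂ + ((D₁ + 1ℚ) + 1ℚ) * S₂) + (D₁ + 1ℚ) * (D₂ + 1ℚ))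
    d t : Vector ℚ n₂
    d y = degree G (ι₂ y)
    t y = hittingTime M (ι₂ y) (ι₂ v₂)
    D₁ = sum (degree G₁)
    -- The start is moved across the bridge to `ι₂ v₂`, which turns the sum into the one-sided sum
    -- for the swapped configuration plus the crossing cost.
    term : ∀ y → d y * hittingTime M (ι₂ y) (ι₁ v₁) ≡ d y * t y + (D₁ + 1ℚ) * d y
    term y = begin
      d y * hittingTime M (ι₂ y) (ι₁ v₁)
        ≡⟨ solve 3 (λ d p q → d :* p := d :* q :+ (p :- q) :* d) refl (d y) (hittingTime M (ι₂ y) (ι₁ v₁)) (t y) ⟩
      d y * t y + (hittingTime M (ι₂ y) (ι₁ v₁) - t y) * d y
        ≡⟨ cong (λ z → d y * t y + z * d y) (hittingTime-bridge B hM y) ⟩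
      d y * t y + (D₁ + 1ℚ) * d y            ∎
    second : sum (λ y → d y * hittingTime M (ι₂ y) (ι₁ v₁))
           ≡ (2ℚ * edges G₂ * κ₂ + ((D₁ + 1ℚ) + 1ℚ) * S₂) + (D₁ + 1ℚ) * (sum (degree G₂) + 1ℚ)
    second = begin
      sum (λ y → d y * hittingTime M (ι₂ y) (ι₁ v₁))                   ≡⟨ sum-cong-≗ term ⟩
      sum (λ y → d y * t y + (D₁ + 1ℚ) * d y)
        ≡⟨ ∑-distrib-+ (λ y → d y * t y) (λ y → (D₁ + 1ℚ) * d y) ⟩
      sum (λ y → d y * t y) + sum (λ y → (D₁ + 1ℚ) * d y)
        ≡⟨ cong₂ _+_ (sum-degree-hittingTime-ι₁ (swap B) hM hκ₂ hR₂) (sym (*-distribˡ-sum (D₁ + 1ℚ) d)) ⟩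
      (2ℚ * edges G₂ * κ₂ + ((D₁ + 1ℚ) + 1ℚ) * S₂) + (D₁ + 1ℚ) * sum d
        ≡⟨ cong (λ z → (2ℚ * edges G₂ * κ₂ + ((D₁ + 1ℚ) + 1ℚ) * S₂) + (D₁ + 1ℚ) * z) (sum-degree-ι₁ (swap B)) ⟩
      (2ℚ * edges G₂ * κ₂ + ((D₁ + 1ℚ) + 1ℚ) * S₂) + (D₁ + 1ℚ) * (sum (degree G₂) + 1ℚ) ∎

  bridgeSum-kemeny :
    ∀ {R₁ R₂ κ κ₁ κ₂} → IsResistanceMatrix G₁ R₁ → IsResistanceMatrix G₂ R₂ →
    IsKemenyConstant G κ → IsKemenyConstant G₁ κ₁ → IsKemenyConstant G₂ κ₂ →
    κ ≡ (edges G₁ ÷₀ edges G) * κ₁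
      + (edges G₂ ÷₀ edges G) * κ₂
      + ((edges G₂ + 1ℚ) ÷₀ edges G) * (degree G₁ ∙ (R₁ *ᵥ basis v₁))
      + ((edges G₁ + 1ℚ) ÷₀ edges G) * (degree G₂ ∙ (R₂ *ᵥ basis v₂))
      + ((2ℚ * edges G₁ + 1ℚ) * (2ℚ * edges G₂ + 1ℚ)) ÷₀ (2ℚ * edges G)
  bridgeSum-kemeny {R₁} {R₂} {κ} {κ₁} {κ₂} hR₁ hR₂ hκ hκ₁ hκ₂ =
    *-cancelˡ-≡ (2ℚ * m) bridgeSum-edges≢0 (trans (bridgeSum-kemeny-scaled hR₁ hR₂ hκ hκ₁ hκ₂) (sym (begin
      2ℚ * m * (q₁ * κ₁ + q₂ * κ₂ + q₃ * S₁ + q₄ * S₂ + q₅)    ≡⟨ distribute 2ℚ m q₁ κ₁ q₂ κ₂ q₃ S₁ q₄ S₂ q₅ ⟩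
      (2ℚ * (m * q₁) * κ₁ + 2ℚ * (m * q₃) * S₁) + ((2ℚ * (m * q₂) * κ₂ + 2ℚ * (m * q₄) * S₂) + 2ℚ * m * q₅)
        ≡⟨ cong₂ _+_
             (cong₂ (λ x y → 2ℚ * x * κ₁ + 2ℚ * y * S₁) (*-÷₀-cancel m≢0) (*-÷₀-cancel m≢0))
             (cong₂ _+_ (cong₂ (λ x y → 2ℚ * x * κ₂ + 2ℚ * y * S₂) (*-÷₀-cancel m≢0) (*-÷₀-cancel m≢0))
                        (*-÷₀-cancel bridgeSum-edges≢0)) ⟩
      (2ℚ * edges G₁ * κ₁ + 2ℚ * (edges G₂ + 1ℚ) * S₁)
        + ((2ℚ * edges G₂ * κ₂ + 2ℚ * (edges G₁ + 1ℚ) * S₂)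
           + (2ℚ * edges G₁ + 1ℚ) * (2ℚ * edges G₂ + 1ℚ))      ∎)))
    where
    open ≡-Reasoning
    m = edges G
    S₁ = degree G₁ ∙ (R₁ *ᵥ basis v₁)
    S₂ = degree G₂ ∙ (R₂ *ᵥ basis v₂)
    q₁ = edges G₁ ÷₀ m
    q₂ = edges G₂ ÷₀ m
    q₃ = (edges G₂ + 1ℚ) ÷₀ m
    q₄ = (edges G₁ + 1ℚ) ÷₀ m
    q₅ = ((2ℚ * edges G₁ + 1ℚ) * (2ℚ * edges G₂ + 1ℚ)) ÷₀ (2ℚ * m)
    m≢0 : m ≢ 0ℚ
    m≢0 m≡0 = bridgeSum-edges≢0 (trans (cong (2ℚ *_) m≡0) (*-zeroʳ 2ℚ))
    distribute : ∀ c m a k b l p s q t r →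
      c * m * (a * k + b * l + p * s + q * t + r) ≡
      (c * (m * a) * k + c * (m * p) * s) + ((c * (m * b) * l + c * (m * q) * t) + c * m * r)
    distribute = solve 11 (λ c m a k b l p s q t r →
      c :* m :* (a :* k :+ b :* l :+ p :* s :+ q :* t :+ r) :=
      (c :* (m :* a) :* k :+ c :* (m :* p) :* s) :+ ((c :* (m :* b) :* l :+ c :* (m :* q) :* t) :+ c :* m :* r)) refl

-- Components of a graph without a bridge

IsPair : ∀ {n} (a b u v : Fin n) → Set
IsPair a b u v = (u ≡ a × v ≡ b) ⊎ (u ≡ b × v ≡ a)

isPair⇒IsPair : ∀ {n} (a b u v : Fin n) → isPair a b u v ≡ true → IsPair a b u v
isPair⇒IsPair a b u v = by-cases (u ≟ a) (v ≟ b) (u ≟ b) (v ≟ a)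
  where
  by-cases : (p : Dec (u ≡ a)) (q : Dec (v ≡ b)) (r : Dec (u ≡ b)) (s : Dec (v ≡ a)) →
             (does p ∧ does q) ∨ (does r ∧ does s) ≡ true → IsPair a b u v
  by-cases (yes p) (yes q) _       _       _ = inj₁ (p , q)
  by-cases (yes _) (no _)  (yes r) (yes s) _ = inj₂ (r , s)
  by-cases (no _)  _       (yes r) (yes s) _ = inj₂ (r , s)

module _ {n} (G : Graph n) (a b : Fin n) where

  private
    G∖e = removeEdge G a b

  adj-removeEdge : ∀ {u v} → ¬ IsPair a b u v → adj G∖e u v ≡ adj G u v
  adj-removeEdge {u} {v} ¬pair = trans
    (cong (λ p → adj G u v ∧ not p) (¬-not (¬pair ∘ isPair⇒IsPair a b u v))) (∧-identityʳ (adj G u v))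

  Adj-removeEdge : ∀ {u v} → Adj G u v → IsPair a b u v ⊎ Adj G∖e u v
  Adj-removeEdge {u} {v} adjacent with isPair a b u v in eq
  ... | true  = inj₁ (isPair⇒IsPair a b u v eq)
  ... | false = inj₂ (subst T (sym (∧-identityʳ (adj G u v))) adjacent)

Reachable-sym : ∀ {n} (G : Graph n) {u v} → Reachable G u v → Reachable G v u
Reachable-sym G = reverse (λ {u} {v} → subst T (adj-sym G u v))

module _ {n k} {G : Graph n} {H : Graph k} {ι : Fin k → Fin n} (C : IsComponent G H ι) where
  open IsComponent C

  component-connected : ∀ x y → Reachable G (ι x) (ι y)
  component-connected x y = Reachable-sym G (from-root x) ◅◅ from-root y
    where
    from-root : ∀ z → Reachable G (ι root) (ι z)
    from-root z = Equivalence.from (class (ι z)) (z , refl)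

  component-closed : ∀ x {v} → Reachable G (ι x) v → ∃[ y ] ι y ≡ v
  component-closed x {v} path = Equivalence.to (class v) (component-connected root x ◅◅ path)

module _ {n n₁ n₂} {G : Graph n} {G₁ : Graph n₁} {G₂ : Graph n₂}
         {ι₁ : Fin n₁ → Fin n} {ι₂ : Fin n₂ → Fin n} {v₁ : Fin n₁} {v₂ : Fin n₂}
         (connected : Connected G) (bridge : IsBridge G (ι₁ v₁) (ι₂ v₂))
         (C₁ : IsComponent (removeEdge G (ι₁ v₁) (ι₂ v₂)) G₁ ι₁)
         (C₂ : IsComponent (removeEdge G (ι₁ v₁) (ι₂ v₂)) G₂ ι₂) where

  private
    a = ι₁ v₁
    b = ι₂ v₂
    G∖e = removeEdge G a b

    module C₁ = IsComponent C₁
    module C₂ = IsComponent C₂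

    Covered : Fin n → Set
    Covered u = (∃[ x ] ι₁ x ≡ u) ⊎ (∃[ y ] ι₂ y ≡ u)

    -- Two components are named, but that there is no third has to be proved. A step along the
    -- bridge lands on one of its ends, and any other step stays in its component, so a walk in the
    -- connected graph never leaves their union.
    covered-step : ∀ {u w} → Covered u → Adj G u w → Covered w
    covered-step {u} {w} cov adjacent = [ along-e , along-G∖e cov ]′ (Adj-removeEdge G a b adjacent)
      where
      along-e : IsPair a b u w → Covered w
      along-e (inj₁ (_ , w≡b)) = inj₂ (v₂ , sym w≡b)
      along-e (inj₂ (_ , w≡a)) = inj₁ (v₁ , sym w≡a)
      along-G∖e : Covered u → Adj G∖e u w → Covered w
      along-G∖e (inj₁ (x , refl)) adj′ = inj₁ (component-closed C₁ x (adj′ ◅ nil))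
      along-G∖e (inj₂ (y , refl)) adj′ = inj₂ (component-closed C₂ y (adj′ ◅ nil))

    covered-walk : ∀ {u w} → Covered u → Reachable G u w → Covered w
    covered-walk cov nil          = cov
    covered-walk cov (s ◅ path) = covered-walk (covered-step cov s) path

    covered : ∀ u → Covered u
    covered u = covered-walk (inj₁ (v₁ , refl)) (connected a u)

    -- A common vertex would be a hub: every covered vertex, hence every vertex, could reach it
    -- without the bridge. Then removing the bridge would leave the graph connected.
    disjoint : ∀ x y → ι₁ x ≢ ι₂ y
    disjoint x y eq = proj₂ bridge (λ u w → to-hub (covered u) ◅◅ Reachable-sym G∖e (to-hub (covered w)))
      where
      to-hub : ∀ {u} → Covered u → Reachable G∖e u (ι₁ x)
      to-hub (inj₁ (z , refl)) = component-connected C₁ z x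
      to-hub (inj₂ (z , refl)) = subst (Reachable G∖e (ι₂ z)) (sym eq) (component-connected C₂ z y)

    coverage : ∀ u → sum (λ x → basis u (ι₁ x)) + sum (λ y → basis u (ι₂ y)) ≡ 1ℚ
    coverage u = by-cases (covered u)
      where
      by-cases : ∀ {u} → Covered u → sum (λ x → basis u (ι₁ x)) + sum (λ y → basis u (ι₂ y)) ≡ 1ℚ
      by-cases (inj₁ (x , refl)) = trans
        (cong₂ _+_ (count-injective C₁.injective x) (sum-zero (λ y → basis-≢ (disjoint x y ∘ sym)))) (+-identityʳ 1ℚ)
      by-cases (inj₂ (y , refl)) = trans
        (cong₂ _+_ (sum-zero (λ x → basis-≢ (disjoint x y))) (count-injective C₂.injective y)) (+-identityˡ 1ℚ)

    not-across : ∀ x y → ¬ Adj G∖e (ι₁ x) (ι₂ y)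
    not-across x y adj′ with z , eq ← component-closed C₁ x (adj′ ◅ nil) = disjoint z y eq

    across : ∀ x y → 𝟙 (adj G (ι₁ x) (ι₂ y)) ≡ basis v₁ x * basis v₂ y
    across x y = by-cases (x ≟ v₁) (y ≟ v₂)
      where
      non-adjacent : ¬ (x ≡ v₁ × y ≡ v₂) → 𝟙 (adj G (ι₁ x) (ι₂ y)) ≡ 0ℚ
      non-adjacent ¬ends = cong 𝟙 (¬-not (λ adj≡true →
        [ (λ { (inj₁ (p , q)) → ¬ends (C₁.injective p , C₂.injective q)
             ; (inj₂ (p , _)) → disjoint x v₂ p })
        , not-across x y ]′ (Adj-removeEdge G a b (Equivalence.from T-≡ adj≡true))))
      by-cases : (d : Dec (x ≡ v₁)) (e : Dec (y ≡ v₂)) →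
                 𝟙 (adj G (ι₁ x) (ι₂ y)) ≡ 𝟙 (does d) * 𝟙 (does e)
      by-cases (yes refl) (yes refl) = cong 𝟙 (Equivalence.to T-≡ (proj₁ bridge))
      by-cases (no x≢v₁)  e          = trans (non-adjacent (x≢v₁ ∘ proj₁)) (sym (*-zeroˡ (𝟙 (does e))))
      by-cases (yes _)    (no y≢v₂)  = non-adjacent (y≢v₂ ∘ proj₂)

  bridge⇒BridgeSum : BridgeSum G G₁ G₂ ι₁ ι₂ v₁ v₂
  bridge⇒BridgeSum = record
    { injective₁ = C₁.injective
    ; injective₂ = C₂.injective
    ; disjoint   = disjoint
    ; ∑-split    = ∑-coverage ι₁ ι₂ coverage
    ; induced₁   = λ x y → sym (trans (C₁.induced x y) (adj-removeEdge G a b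
        (λ { (inj₁ (_ , q)) → disjoint y v₂ q ; (inj₂ (p , _)) → disjoint x v₂ p })))
    ; induced₂   = λ x y → sym (trans (C₂.induced x y) (adj-removeEdge G a b
        (λ { (inj₁ (p , _)) → disjoint v₁ x (sym p) ; (inj₂ (_ , q)) → disjoint v₁ y (sym q) })))
    ; across     = across
    }

proposition2p2 : ∀ {n n₁ n₂ : ℕ} (G : Graph n) (G₁ : Graph n₁) (G₂ : Graph n₂)
    (ι₁ : Fin n₁ → Fin n) (ι₂ : Fin n₂ → Fin n) (v₁ : Fin n₁) (v₂ : Fin n₂) →
    Connected G →
    IsBridge G (ι₁ v₁) (ι₂ v₂) →
    IsComponent (removeEdge G (ι₁ v₁) (ι₂ v₂)) G₁ ι₁ →
    IsComponent (removeEdge G (ι₁ v₁) (ι₂ v₂)) G₂ ι₂ →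
    ∀ (R₁ : Matrix n₁ n₁) (R₂ : Matrix n₂ n₂) →
    IsResistanceMatrix G₁ R₁ →
    IsResistanceMatrix G₂ R₂ →
    ∀ (κ κ₁ κ₂ : ℚ) →
    IsKemenyConstant G κ →
    IsKemenyConstant G₁ κ₁ →
    IsKemenyConstant G₂ κ₂ →
    κ ≡ (edges G₁ ÷₀ edges G) * κ₁
    + (edges G₂ ÷₀ edges G) * κ₂
    + ((edges G₂ + 1ℚ) ÷₀ edges G) * (degree G₁ ∙ (R₁ *ᵥ basis v₁))
    + ((edges G₁ + 1ℚ) ÷₀ edges G) * (degree G₂ ∙ (R₂ *ᵥ basis v₂))
    + ((2ℚ * edges G₁ + 1ℚ) * (2ℚ * edges G₂ + 1ℚ)) ÷₀ (2ℚ * edges G)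
proposition2p2 G G₁ G₂ ι₁ ι₂ v₁ v₂ connected bridge C₁ C₂ R₁ R₂ hR₁ hR₂ κ κ₁ κ₂ hκ hκ₁ hκ₂ =
  bridgeSum-kemeny (bridge⇒BridgeSum connected bridge C₁ C₂) hR₁ hR₂ hκ hκ₁ hκ₂
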